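{- As formal power series in $x$ with coefficients in $\mathbb{Z}[t]$, $$\sum_{n\geq 0}\ \sum_{T\in \mathcal{PT}(n)} t^{\operatorname{urc}(T)} x^n = \frac{1+E_t(x)}{1+(t-1)\,x\,E_t(x)},\qquad\text{where}\qquad E_t(x)=\sum_{n\geq 1} n\,(t)_{n-1}\,x^n .$$
   Context: Rising factorial: $(t)_0=1$ and $(t)_n=t(t+1)\cdots(t+n-1)$ for $n\ge 1$. Ferrers diagrams: a Ferrers diagram is a left-justified arrangement of square cells, possibly with empty rows; its length is the number of rows plus the number of columns. The steps of the south-east border are labeled $1,\dots,n$ from north-east to south-west ($n$ the length); a row gets the label of its south step and a column the label of its west step. Equivalently, a diagram of length $n$ is a splitting of $\{1,\dots,n\}$ into row labels and column labels; rows are listed top to bottom in increasing order of label, columns left to right in decreasing order of label, and there is a cell in Row $r$ and Column $c$ exactly when $r<c$. Permutation tableaux: a permutation tableau is a Ferrers diagram with a filling of its cells by $0$'s and $1$'s such that (1) each column has at least one $1$; (2) there is no $0$ having both a $1$ above it in the same column and a $1$ to the left of it in the same row. $\mathcal{PT}(n)$ is the set of permutation tableaux of length $n$ ($\mathcal{PT}(0)$ consists of the single empty tableau). A column is unrestricted if it contains no $0$ that has a $1$ to the left of it in the same row; $\operatorname{urc}(T)$ is the number of unrestricted columns of $T$. -}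

module Defs where

open import Algebra.Bundles using (Ring)
open import Algebra.Bundles.Raw using (RawRing)
import Algebra.Definitions.RawSemiring as RawSemiringDefs
open import Data.Bool.Base using (true; false)
open import Data.Fin.Base using (Fin; zero; suc; toℕ; _<_)
open import Data.Fin.Properties using (_<?_; any?; all?)
open import Data.Fin.Subset using (Subset; _∈_)
open import Data.Fin.Subset.Properties using (_∈?_)
open import Data.Integer.Base as ℤ using (ℤ; 0ℤ; 1ℤ)
open import Data.List.Base using (List; []; _∷_; map; foldr; filter; length; allFin; cartesianProductWith)
open import Data.List.Membership.Propositional using () renaming (_∈_ to _∈ₗ_)
open import Data.List.Membership.Propositional.Properties using (∈-cartesianProductWith⁺; ∈-filter⁺; ∈-filter⁻)
open import Data.List.Relation.Unary.All as All using (All)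
open import Data.List.Relation.Unary.AllPairs as AllPairs using (AllPairs)
open import Data.List.Relation.Unary.Any using (here; there)
open import Data.List.Relation.Unary.Unique.Propositional using (Unique)
import Data.List.Relation.Unary.Unique.Propositional.Properties as Unique
open import Data.Nat.Base using (ℕ; zero; suc; _∸_)
open import Data.Product.Base using (∃-syntax; _×_; _,_; proj₂)
open import Data.Vec.Base as Vec using (Vec; []; _∷_; lookup)
open import Data.Vec.Properties using (∷-injective)
open import Function.Base using (_∘_)
open import Function.Bundles using (_⇔_; mk⇔)
open import Level using (0ℓ)
open import Relation.Binary.PropositionalEquality as ≡ using (_≡_; refl)
open import Relation.Nullary.Decidable using (Dec; yes; no; map′; ¬?; _×-dec_; _→-dec_)
open import Relation.Nullary.Negation using (¬_)

data Step : Set where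
  south west : Step

_≟ˢ_ : (s s′ : Step) → Dec (s ≡ s′)
south ≟ˢ south = yes refl
south ≟ˢ west  = no λ ()
west  ≟ˢ south = no λ ()
west  ≟ˢ west  = yes refl

-- A Ferrers diagram of length n is its south-east border, read from
-- north-east to south-west; the label i + 1 is represented by i : Fin n.
Diagram : ℕ → Set
Diagram = Vec Step

module _ {n} (D : Diagram n) where

  IsRow IsColumn : Fin n → Set
  IsRow    i = lookup D i ≡ south
  IsColumn i = lookup D i ≡ west

  Cell : (r c : Fin n) → Set
  Cell r c = IsRow r × IsColumn c × r < c

  isColumn? : ∀ i → Dec (IsColumn i)
  isColumn? i = lookup D i ≟ˢ west

  cell? : ∀ r c → Dec (Cell r c)
  cell? r c = (lookup D r ≟ˢ south) ×-dec isColumn? c ×-dec (r <? c)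

-- A 0/1-filling is given by the positions of its 1's: c ∈ lookup ones r
-- means that there is a 1 in Row r and Column c.  That these positions are
-- cells of the diagram is part of IsPermutationTableau.
record Tableau (n : ℕ) : Set where
  constructor tableau
  field
    diagram : Diagram n
    ones    : Vec (Subset n) n

module _ {n} (T : Tableau n) where
  open Tableau T

  One Zero : (r c : Fin n) → Set
  One  r c = c ∈ lookup ones r
  Zero r c = Cell diagram r c × ¬ One r c

  -- Rows increase downwards, but columns decrease from left to right, so a
  -- cell further left has the larger column label.
  OneAbove OneToTheLeft : (r c : Fin n) → Set
  OneAbove     r c = ∃[ r′ ] r′ < r × One r′ c
  OneToTheLeft r c = ∃[ c′ ] c < c′ × One r c′

  record IsPermutationTableau : Set where
    field
      ones-in-cells : ∀ r c → One r c → Cell diagram r c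
      column-has-1  : ∀ c → IsColumn diagram c → ∃[ r ] One r c
      no-bad-0      : ∀ r c → ¬ (Zero r c × OneAbove r c × OneToTheLeft r c)

  UnrestrictedColumn : Fin n → Set
  UnrestrictedColumn c = IsColumn diagram c × ¬ (∃[ r ] Zero r c × OneToTheLeft r c)

  one? : ∀ r c → Dec (One r c)
  one? r c = c ∈? lookup ones r

  zero? : ∀ r c → Dec (Zero r c)
  zero? r c = cell? diagram r c ×-dec ¬? (one? r c)

  oneAbove? : ∀ r c → Dec (OneAbove r c)
  oneAbove? r c = any? λ r′ → (r′ <? r) ×-dec one? r′ c

  oneToTheLeft? : ∀ r c → Dec (OneToTheLeft r c)
  oneToTheLeft? r c = any? λ c′ → (c <? c′) ×-dec one? r c′

  isPermutationTableau? : Dec IsPermutationTableau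
  isPermutationTableau? = map′
    (λ (p , q , s) → record { ones-in-cells = p ; column-has-1 = q ; no-bad-0 = s })
    (λ P → let open IsPermutationTableau P in ones-in-cells , column-has-1 , no-bad-0)
    ((all? λ r → all? λ c → one? r c →-dec cell? diagram r c)
      ×-dec (all? λ c → isColumn? diagram c →-dec any? λ r → one? r c)
      ×-dec (all? λ r → all? λ c → ¬? (zero? r c ×-dec oneAbove? r c ×-dec oneToTheLeft? r c)))

  unrestrictedColumn? : ∀ c → Dec (UnrestrictedColumn c)
  unrestrictedColumn? c =
    isColumn? diagram c ×-dec ¬? (any? λ r → zero? r c ×-dec oneToTheLeft? r c)

  urc : ℕ
  urc = length (filter unrestrictedColumn? (allFin n))

allVecs : ∀ {A : Set} → List A → ∀ n → List (Vec A n)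
allVecs xs zero    = [] ∷ []
allVecs xs (suc n) = cartesianProductWith _∷_ xs (allVecs xs n)

allTableaux : ∀ n → List (Tableau n)
allTableaux n = cartesianProductWith tableau
  (allVecs (south ∷ west ∷ []) n)
  (allVecs (allVecs (false ∷ true ∷ []) n) n)

PT : ∀ n → List (Tableau n)
PT n = filter isPermutationTableau? (allTableaux n)

private
  allVecs-complete : ∀ {A : Set} {xs : List A} → (∀ x → x ∈ₗ xs) →
                     ∀ {n} (v : Vec A n) → v ∈ₗ allVecs xs n
  allVecs-complete all []      = here refl
  allVecs-complete all (x ∷ v) =
    ∈-cartesianProductWith⁺ _∷_ (all x) (allVecs-complete all v)

  allVecs-unique : ∀ {A : Set} {xs : List A} → Unique xs → ∀ n → Unique (allVecs xs n)
  allVecs-unique u zero    = All.[] AllPairs.∷ AllPairs.[]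
  allVecs-unique u (suc n) =
    Unique.cartesianProductWith⁺ _∷_ ∷-injective u (allVecs-unique u n)

∈-PT : ∀ {n} (T : Tableau n) → T ∈ₗ PT n ⇔ IsPermutationTableau T
∈-PT {n} T@(tableau D F) = mk⇔
  (λ T∈PT → proj₂ (∈-filter⁻ isPermutationTableau? {xs = allTableaux n} T∈PT))
  (∈-filter⁺ isPermutationTableau?
    (∈-cartesianProductWith⁺ tableau
      (allVecs-complete (λ { south → here refl ; west → there (here refl) }) D)
      (allVecs-complete
        (allVecs-complete λ { false → here refl ; true → there (here refl) }) F)))

PT-unique : ∀ n → Unique (PT n)
PT-unique n = Unique.filter⁺ isPermutationTableau?
  (Unique.cartesianProductWith⁺ tableau (λ { refl → refl , refl })
    (allVecs-unique (((λ ()) All.∷ All.[]) AllPairs.∷ All.[] AllPairs.∷ AllPairs.[]) n)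
    (allVecs-unique
      (allVecs-unique (((λ ()) All.∷ All.[]) AllPairs.∷ All.[] AllPairs.∷ AllPairs.[]) n) n))

module Polynomial where

  -- Coefficient lists, starting with the constant term.
  Poly : Set
  Poly = List ℤ

  coeff : Poly → ℕ → ℤ
  coeff []      k       = 0ℤ
  coeff (a ∷ p) zero    = a
  coeff (a ∷ p) (suc k) = coeff p k

  -- Trailing zeros are allowed, so equality is coefficientwise.
  infix 4 _≈_
  record _≈_ (p q : Poly) : Set where
    constructor mk≈
    field
      coeff-≡ : ∀ k → coeff p k ≡ coeff q k

  infixl 6 _+_
  _+_ : Poly → Poly → Poly
  []      + q       = q
  (a ∷ p) + []      = a ∷ p
  (a ∷ p) + (b ∷ q) = (a ℤ.+ b) ∷ (p + q)

  infixl 7 _*_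
  _*_ : Poly → Poly → Poly
  []      * q = []
  (a ∷ p) * q = map (a ℤ.*_) q + (0ℤ ∷ p * q)

  t : Poly
  t = 0ℤ ∷ 1ℤ ∷ []

ℤ[t] : RawRing 0ℓ 0ℓ
ℤ[t] = record
  { Carrier = Poly
  ; _≈_     = _≈_
  ; _+_     = _+_
  ; _*_     = _*_
  ; -_      = map (λ a → ℤ.- a)
  ; 0#      = []
  ; 1#      = 1ℤ ∷ []
  }
  where open Polynomial

module PowerSeries {c ℓ} (R : RawRing c ℓ) where
  open RawRing R
  open RawSemiringDefs rawSemiring using (sum)

  Series : Set c
  Series = ℕ → Carrier

  infixl 7 _*ₛ_
  _*ₛ_ : Series → Series → Series
  (f *ₛ g) n = sum {suc n} λ i → f (toℕ i) * g (n ∸ toℕ i)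

  constant : Carrier → Series
  constant a zero    = a
  constant a (suc n) = 0#

  x : Series
  x zero          = 0#
  x (suc zero)    = 1#
  x (suc (suc n)) = 0#

  R⟦x⟧ : RawRing c ℓ
  R⟦x⟧ = record
    { Carrier = Series
    ; _≈_     = λ f g → ∀ n → f n ≈ g n
    ; _+_     = λ f g n → f n + g n
    ; _*_     = _*ₛ_
    ; -_      = λ f n → - f n
    ; 0#      = constant 0#
    ; 1#      = constant 1#
    }

  -- The coefficients h n , … , h 0 of the inverse h of g, obtained by solving
  -- g * h = 1 recursively; meaningful when g has constant coefficient 1.
  inverseCoeffs : Series → ∀ n → Vec Carrier (suc n)
  inverseCoeffs g zero    = 1# ∷ []
  inverseCoeffs g (suc n) =
    (- sum {suc n} λ i → g (suc (toℕ i)) * lookup (inverseCoeffs g n) i)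
    ∷ inverseCoeffs g n

  _⁻¹ : Series → Series
  (g ⁻¹) n = Vec.head (inverseCoeffs g n)

  infixl 7 _/_
  _/_ : Series → Series → Series
  f / g = f *ₛ g ⁻¹

module _ {c ℓ} (R : Ring c ℓ) where
  open Ring R hiding (refl)
  open PowerSeries rawRing
  open import Algebra.Properties.CommutativeMonoid.Sum +-commutativeMonoid using (sum; sum-cong-≗)
  open import Relation.Binary.Reasoning.Setoid setoid
  private module S = RawRing R⟦x⟧

  private
    lookup-inverseCoeffs : ∀ g n (i : Fin (suc n)) →
                           lookup (inverseCoeffs g n) i ≡ (g ⁻¹) (n ∸ toℕ i)
    lookup-inverseCoeffs g zero    zero    = refl
    lookup-inverseCoeffs g (suc n) zero    = refl
    lookup-inverseCoeffs g (suc n) (suc i) = lookup-inverseCoeffs g n i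

  *-inverseʳ : ∀ g → g 0 ≈ 1# → (g S.* g ⁻¹) S.≈ S.1#
  *-inverseʳ g g₀≈1 zero    = begin
    g 0 * 1# + 0#  ≈⟨ +-identityʳ _ ⟩
    g 0 * 1#       ≈⟨ *-identityʳ _ ⟩
    g 0            ≈⟨ g₀≈1 ⟩
    1#             ∎
  *-inverseʳ g g₀≈1 (suc n) = begin
    g 0 * - Σ + Σ′  ≈⟨ +-congʳ (*-congʳ g₀≈1) ⟩
    1# * - Σ + Σ′   ≈⟨ +-congʳ (*-identityˡ _) ⟩
    - Σ + Σ′        ≡⟨ ≡.cong (- Σ +_) Σ≡Σ′ ⟨
    - Σ + Σ         ≈⟨ -‿inverseˡ Σ ⟩
    0#              ∎
    where
    Σ Σ′ : Carrier
    Σ  = sum {suc n} λ i → g (suc (toℕ i)) * lookup (inverseCoeffs g n) i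
    Σ′ = sum {suc n} λ i → g (suc (toℕ i)) * (g ⁻¹) (n ∸ toℕ i)

    Σ≡Σ′ : Σ ≡ Σ′
    Σ≡Σ′ = sum-cong-≗ λ i → ≡.cong (g (suc (toℕ i)) *_) (lookup-inverseCoeffs g n i)

open Polynomial public using (t)
open PowerSeries ℤ[t] public using (Series; constant; x; _/_) renaming (R⟦x⟧ to ℤ[t]⟦x⟧)

module _ where
  open RawRing ℤ[t]
  open RawSemiringDefs rawSemiring using (_^_) renaming (_×_ to _·_)

  t-1 : Carrier
  t-1 = t + - 1#

  risingFactorial : Carrier → ℕ → Carrier
  risingFactorial a zero    = 1#
  risingFactorial a (suc n) = risingFactorial a n * (a + n · 1#)

  E : Series
  E zero    = 0#
  E (suc m) = suc m · risingFactorial t m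

  tableauSeries : Series
  tableauSeries n = foldr _+_ 0# (map (λ T → t ^ urc T) (PT n))

module _ where
  open RawRing ℤ[t]⟦x⟧

  denominator₀≈1 : RawRing._≈_ ℤ[t] ((1# + constant t-1 * x * E) 0) (RawRing.1# ℤ[t])
  denominator₀≈1 = Polynomial.mk≈ λ where
    zero                → refl
    (suc zero)          → refl
    (suc (suc zero))    → refl
    (suc (suc (suc k))) → refl

-- Build a tableau by prepending labels, i.e. by adding a column without cells
-- on the right or a row on top.  Only the word of unrestricted columns matters,
-- with letters e (no 1 yet) and u (at least one 1): a new column appends e, and
-- a new row acts by an operator S on ℤ⟨e, u⟩.  The point is that
-- v = u - e - 1 satisfies S (w v y) = w v S y for all words w, y, while S
-- maps a polynomial p in u to u p(u+1) + (1 - u) p(u).  Since e = u - 1 - v,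
-- one step turns w v p(u) into w v u p(u+1) - w v p(u) v.  Evaluating e = 0,
-- u = t, v = t - 1, the polynomials u(u+1)⋯(u+k-1) become (t)ₖ, so with
-- R = Σ (t)ₙ xⁿ the series G of the theorem satisfies G + (t-1) x R G = R.
-- Finally 1 + E + (t-1) x R = R, and eliminating R gives G (1 + (t-1) x E) = 1 + E.

module Submission where

open import Defs
open import Algebra.Bundles using (CommutativeRing)
open import Algebra.Bundles.Raw using (RawRing)
import Algebra.Definitions.RawSemiring as RawSemiringDefs
import Algebra.Morphism.RingMonomorphism as RingMonomorphism
open import Algebra.Morphism.Structures using (IsRingMonomorphism)
import Algebra.Properties.CommutativeSemigroup as CommutativeSemigroup
import Algebra.Properties.Group as GroupProperties
import Algebra.Solver.Ring.NaturalCoefficients.Default as SemiringSolver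
open import Data.Bool.Base using (Bool; true; false; _∧_; _∨_; not; if_then_else_)
open import Data.Bool.Properties using (not-¬; ¬-not; ∨-zeroʳ)
open import Data.Empty using (⊥-elim)
open import Data.Fin.Base using (Fin; zero; suc; _<_)
open import Data.Fin.Properties using (any?; all?; ¬∀⟶∃¬)
open import Data.Fin.Subset using (Subset; _∈_; _∉_)
open import Data.Fin.Subset.Properties using (drop-there)
import Data.Integer.Base as ℤ
import Data.Integer.Properties as ℤ
open import Data.List.Base using (List; []; _∷_; _++_; map; foldr; filter; length; tabulate; cartesianProductWith)
open import Data.Nat.Base as ℕ using (ℕ; zero; suc; z<s; s<s)
import Data.Nat.Properties as ℕ
open import Data.Product.Base using (∃-syntax; _×_; _,_; proj₁; proj₂)
open import Data.Sum.Base using (_⊎_; inj₁; inj₂; [_,_]′)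
open import Data.Vec.Base as Vec using (Vec; []; _∷_; lookup; here; there)
open import Data.Vec.Properties using (lookup-map; lookup⇒[]=; []=⇒lookup)
open import Function.Base using (_∘_; id)
open import Function.Bundles using (_⇔_; mk⇔; Equivalence)
open import Relation.Binary.PropositionalEquality as ≡ using (_≡_)
import Relation.Binary.Reasoning.Setoid as ≈-Reasoning
open import Relation.Nullary.Decidable
  using (Dec; yes; no; does; map′; ¬?; _×-dec_; _→-dec_; dec-true; dec-false; decidable-stable)
open import Relation.Nullary.Negation using (¬_; contradiction)
open import Relation.Unary using (Decidable)

open Equivalence using (to; from)

-- Power series and polynomials

module PowerSeriesRing {c ℓ} (R : CommutativeRing c ℓ) where
  open CommutativeRing R
  private module S = PowerSeries rawRing
  open S using (_*ₛ_; R⟦x⟧)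
  open CommutativeSemigroup +-commutativeSemigroup using () renaming (interchange to +-interchange)
  open ≈-Reasoning setoid
  private
    infix 4 _≋_
    _≋_ = RawRing._≈_ R⟦x⟧
    infixl 6 _⊕_
    _⊕_ = RawRing._+_ R⟦x⟧

  infixr 7 _·_
  _·_ : Carrier → S.Series → S.Series
  (a · f) n = a * f n

  -- Unlike `S.constant 0#`, this form is unchanged by composition with `suc`, which is what the
  -- inductions on the degree produce.
  0ₛ : S.Series
  0ₛ _ = 0#

  -- By definition `(f *ₛ g) (suc n)` unfolds to `f 0 * g (suc n) + ((f ∘ suc) *ₛ g) n`; this and
  -- most product laws below are inductions on the degree along that unfolding.
  *ₛ-cong : ∀ {f f′ g g′} → f ≋ f′ → g ≋ g′ → f *ₛ g ≋ f′ *ₛ g′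
  *ₛ-cong f≋ g≋ zero    = +-congʳ (*-cong (f≋ 0) (g≋ 0))
  *ₛ-cong f≋ g≋ (suc n) = +-cong (*-cong (f≋ 0) (g≋ (suc n))) (*ₛ-cong (f≋ ∘ suc) g≋ n)

  *ₛ-zeroˡ : ∀ f → 0ₛ *ₛ f ≋ 0ₛ
  *ₛ-zeroˡ f zero    = trans (+-identityʳ _) (zeroˡ _)
  *ₛ-zeroˡ f (suc n) = trans (+-cong (zeroˡ _) (*ₛ-zeroˡ f n)) (+-identityʳ _)

  constant-*ₛ : ∀ a f → S.constant a *ₛ f ≋ a · f
  constant-*ₛ a f zero    = +-identityʳ _
  constant-*ₛ a f (suc n) = trans (+-congˡ (*ₛ-zeroˡ f n)) (+-identityʳ _)

  ·-*ₛ : ∀ a f g → (a · f) *ₛ g ≋ a · (f *ₛ g)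
  ·-*ₛ a f g zero    = begin
    a * f 0 * g 0 + 0#       ≈⟨ +-cong (*-assoc _ _ _) (sym (zeroʳ a)) ⟩
    a * (f 0 * g 0) + a * 0# ≈⟨ distribˡ _ _ _ ⟨
    a * (f 0 * g 0 + 0#)     ∎
  ·-*ₛ a f g (suc n) = begin
    a * f 0 * g (suc n) + ((a · (f ∘ suc)) *ₛ g) n   ≈⟨ +-cong (*-assoc _ _ _) (·-*ₛ a (f ∘ suc) g n) ⟩
    a * (f 0 * g (suc n)) + a * ((f ∘ suc) *ₛ g) n   ≈⟨ distribˡ _ _ _ ⟨
    a * (f 0 * g (suc n) + ((f ∘ suc) *ₛ g) n)       ∎

  *ₛ-distribʳ : ∀ h f g → (f ⊕ g) *ₛ h ≋ f *ₛ h ⊕ g *ₛ h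
  *ₛ-distribʳ h f g zero    = begin
    (f 0 + g 0) * h 0 + 0#                 ≈⟨ +-cong (distribʳ _ _ _) (sym (+-identityʳ _)) ⟩
    f 0 * h 0 + g 0 * h 0 + (0# + 0#)      ≈⟨ +-interchange _ _ _ _ ⟩
    f 0 * h 0 + 0# + (g 0 * h 0 + 0#)      ∎
  *ₛ-distribʳ h f g (suc n) = begin
    (f 0 + g 0) * h (suc n) + (((f ∘ suc) ⊕ (g ∘ suc)) *ₛ h) n
      ≈⟨ +-cong (distribʳ _ _ _) (*ₛ-distribʳ h (f ∘ suc) (g ∘ suc) n) ⟩
    f 0 * h (suc n) + g 0 * h (suc n) + (((f ∘ suc) *ₛ h) n + ((g ∘ suc) *ₛ h) n)
      ≈⟨ +-interchange _ _ _ _ ⟩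
    (f *ₛ h) (suc n) + (g *ₛ h) (suc n) ∎

  -- Splitting off the last summand mirrors the unfolding, which splits off the first; commutativity
  -- plays one against the other.
  *ₛ-suc : ∀ f g n → (f *ₛ g) (suc n) ≈ (f *ₛ (g ∘ suc)) n + f (suc n) * g 0
  *ₛ-suc f g zero    = begin
    f 0 * g 1 + (f 1 * g 0 + 0#)   ≈⟨ +-cong (sym (+-identityʳ _)) (+-identityʳ _) ⟩
    f 0 * g 1 + 0# + f 1 * g 0     ∎
  *ₛ-suc f g (suc n) = trans (+-congˡ (*ₛ-suc (f ∘ suc) g n)) (sym (+-assoc _ _ _))

  *ₛ-comm : ∀ f g → f *ₛ g ≋ g *ₛ f
  *ₛ-comm f g zero    = +-congʳ (*-comm _ _)
  *ₛ-comm f g (suc n) = begin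
    f 0 * g (suc n) + ((f ∘ suc) *ₛ g) n   ≈⟨ +-comm _ _ ⟩
    ((f ∘ suc) *ₛ g) n + f 0 * g (suc n)   ≈⟨ +-cong (*ₛ-comm (f ∘ suc) g n) (*-comm _ _) ⟩
    (g *ₛ (f ∘ suc)) n + g (suc n) * f 0   ≈⟨ *ₛ-suc g f n ⟨
    (g *ₛ f) (suc n)                       ∎

  *ₛ-assoc : ∀ f g h → (f *ₛ g) *ₛ h ≋ f *ₛ (g *ₛ h)
  *ₛ-assoc f g h zero    = +-congʳ (begin
    (f 0 * g 0 + 0#) * h 0   ≈⟨ *-congʳ (+-identityʳ _) ⟩
    f 0 * g 0 * h 0          ≈⟨ *-assoc _ _ _ ⟩
    f 0 * (g 0 * h 0)        ≈⟨ *-congˡ (+-identityʳ _) ⟨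
    f 0 * (g 0 * h 0 + 0#)   ∎)
  *ₛ-assoc f g h (suc n) = begin
    (f 0 * g 0 + 0#) * h (suc n) + ((f 0 · g′ ⊕ f′ *ₛ g) *ₛ h) n
      ≈⟨ +-cong (*-congʳ (+-identityʳ _)) (*ₛ-distribʳ h (f 0 · g′) (f′ *ₛ g) n) ⟩
    f 0 * g 0 * h (suc n) + (((f 0 · g′) *ₛ h) n + ((f′ *ₛ g) *ₛ h) n)
      ≈⟨ +-cong (*-assoc _ _ _) (+-cong (·-*ₛ (f 0) g′ h n) (*ₛ-assoc f′ g h n)) ⟩
    f 0 * (g 0 * h (suc n)) + (f 0 * (g′ *ₛ h) n + (f′ *ₛ (g *ₛ h)) n)
      ≈⟨ +-assoc _ _ _ ⟨
    f 0 * (g 0 * h (suc n)) + f 0 * (g′ *ₛ h) n + (f′ *ₛ (g *ₛ h)) n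
      ≈⟨ +-congʳ (distribˡ _ _ _) ⟨
    f 0 * (g *ₛ h) (suc n) + (f′ *ₛ (g *ₛ h)) n ∎
    where
    f′ g′ : S.Series
    f′ = f ∘ suc
    g′ = g ∘ suc

  *ₛ-identityˡ : ∀ f → S.constant 1# *ₛ f ≋ f
  *ₛ-identityˡ f n = trans (constant-*ₛ 1# f n) (*-identityˡ _)

  x*-zero : ∀ f → (S.x *ₛ f) 0 ≈ 0#
  x*-zero f = trans (+-identityʳ _) (zeroˡ _)

  x*-suc : ∀ f n → (S.x *ₛ f) (suc n) ≈ f n
  x*-suc f n = begin
    0# * f (suc n) + ((S.x ∘ suc) *ₛ f) n   ≈⟨ +-cong (zeroˡ _) (*ₛ-cong {g = f} x∘suc≋1 (λ _ → refl) n) ⟩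
    0# + (S.constant 1# *ₛ f) n             ≈⟨ +-identityˡ _ ⟩
    (S.constant 1# *ₛ f) n                  ≈⟨ *ₛ-identityˡ f n ⟩
    f n                                     ∎
    where
    x∘suc≋1 : S.x ∘ suc ≋ S.constant 1#
    x∘suc≋1 zero    = refl
    x∘suc≋1 (suc n) = refl

  constant*x*-zero : ∀ a f → (S.constant a *ₛ S.x *ₛ f) 0 ≈ 0#
  constant*x*-zero a f = begin
    (S.constant a *ₛ S.x *ₛ f) 0     ≈⟨ *ₛ-assoc (S.constant a) S.x f 0 ⟩
    (S.constant a *ₛ (S.x *ₛ f)) 0   ≈⟨ constant-*ₛ a (S.x *ₛ f) 0 ⟩
    a * (S.x *ₛ f) 0                 ≈⟨ *-congˡ (x*-zero f) ⟩
    a * 0#                           ≈⟨ zeroʳ a ⟩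
    0#                               ∎

  constant*x*-suc : ∀ a f n → (S.constant a *ₛ S.x *ₛ f) (suc n) ≈ a * f n
  constant*x*-suc a f n = begin
    (S.constant a *ₛ S.x *ₛ f) (suc n)     ≈⟨ *ₛ-assoc (S.constant a) S.x f (suc n) ⟩
    (S.constant a *ₛ (S.x *ₛ f)) (suc n)   ≈⟨ constant-*ₛ a (S.x *ₛ f) (suc n) ⟩
    a * (S.x *ₛ f) (suc n)                 ≈⟨ *-congˡ (x*-suc f n) ⟩
    a * f n                                ∎

  constant-0# : S.constant 0# ≋ 0ₛ
  constant-0# zero    = refl
  constant-0# (suc n) = refl

  powerSeriesRing : CommutativeRing c ℓ
  powerSeriesRing = record
    { RawRing R⟦x⟧
    ; isCommutativeRing = record
      { isRing = record
        { +-isAbelianGroup = record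
          { isGroup = record
            { isMonoid = record
              { isSemigroup = record
                { isMagma = record
                  { isEquivalence = record
                    { refl  = λ n → refl
                    ; sym   = λ p n → sym (p n)
                    ; trans = λ p q n → trans (p n) (q n)
                    }
                  ; ∙-cong = λ p q n → +-cong (p n) (q n)
                  }
                ; assoc = λ f g h n → +-assoc _ _ _
                }
              ; identity = (λ f n → trans (+-congʳ (constant-0# n)) (+-identityˡ _))
                         , (λ f n → trans (+-congˡ (constant-0# n)) (+-identityʳ _))
              }
            ; inverse = (λ f n → trans (-‿inverseˡ _) (sym (constant-0# n)))
                      , (λ f n → trans (-‿inverseʳ _) (sym (constant-0# n)))
            ; ⁻¹-cong = λ p n → -‿cong (p n)
            }
          ; comm = λ f g n → +-comm _ _
          }
        ; *-cong = *ₛ-cong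
        ; *-assoc = *ₛ-assoc
        ; *-identity = *ₛ-identityˡ , λ f n → trans (*ₛ-comm f (S.constant 1#) n) (*ₛ-identityˡ f n)
        ; distrib = (λ f g h n → trans (*ₛ-comm f (g ⊕ h) n)
                       (trans (*ₛ-distribʳ f g h n) (+-cong (*ₛ-comm g f n) (*ₛ-comm h f n))))
                  , *ₛ-distribʳ
        }
      ; *-comm = *ₛ-comm
      }
    }

module ℤ⟦t⟧ = PowerSeriesRing ℤ.+-*-commutativeRing

module PolynomialRing where
  open Polynomial
  open PowerSeries (CommutativeRing.rawRing ℤ.+-*-commutativeRing) using (_*ₛ_)

  coeff-+ : ∀ p q n → coeff (p + q) n ≡ coeff p n ℤ.+ coeff q n
  coeff-+ []      q       n       = ≡.sym (ℤ.+-identityˡ _)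
  coeff-+ (a ∷ p) []      n       = ≡.sym (ℤ.+-identityʳ _)
  coeff-+ (a ∷ p) (b ∷ q) zero    = ≡.refl
  coeff-+ (a ∷ p) (b ∷ q) (suc n) = coeff-+ p q n

  coeff-map : ∀ {f : ℤ.ℤ → ℤ.ℤ} → f ℤ.0ℤ ≡ ℤ.0ℤ → ∀ p n → coeff (map f p) n ≡ f (coeff p n)
  coeff-map f0 []      n       = ≡.sym f0
  coeff-map f0 (a ∷ p) zero    = ≡.refl
  coeff-map f0 (a ∷ p) (suc n) = coeff-map f0 p n

  coeff-* : ∀ p q n → coeff (p * q) n ≡ (coeff p *ₛ coeff q) n
  coeff-* []      q n       = ≡.sym (ℤ⟦t⟧.*ₛ-zeroˡ (coeff q) n)
  coeff-* (a ∷ p) q n = ≡.trans (coeff-+ (map (a ℤ.*_) q) _ n)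
    (≡.trans (≡.cong (ℤ._+ coeff (ℤ.0ℤ ∷ p * q) n) (coeff-map (ℤ.*-zeroʳ a) q n)) (tail n))
    where
    tail : ∀ n → a ℤ.* coeff q n ℤ.+ coeff (ℤ.0ℤ ∷ p * q) n ≡ (coeff (a ∷ p) *ₛ coeff q) n
    tail zero    = ≡.refl
    tail (suc n) = ≡.cong (λ b → (a ℤ.* coeff q (suc n)) ℤ.+ b) (coeff-* p q n)

  -- Equality of polynomials is coefficientwise, so injectivity is immediate, and the ring laws of
  -- polynomials can be pulled back from power series.
  coeff-isRingMonomorphism :
    IsRingMonomorphism ℤ[t] (CommutativeRing.rawRing ℤ⟦t⟧.powerSeriesRing) coeff
  coeff-isRingMonomorphism = record
    { isRingHomomorphism = record
      { isSemiringHomomorphism = record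
        { isNearSemiringHomomorphism = record
          { +-isMonoidHomomorphism = record
            { isMagmaHomomorphism = record
              { isRelHomomorphism = record { cong = _≈_.coeff-≡ }
              ; homo = coeff-+
              }
            ; ε-homo = λ { zero → ≡.refl ; (suc n) → ≡.refl }
            }
          ; *-homo = coeff-*
          }
        ; 1#-homo = λ { zero → ≡.refl ; (suc n) → ≡.refl }
        }
      ; -‿homo = coeff-map ≡.refl
      }
    ; injective = mk≈
    }

  ℤ[t]-commutativeRing : CommutativeRing _ _
  ℤ[t]-commutativeRing = record
    { RawRing ℤ[t]
    ; isCommutativeRing = RingMonomorphism.isCommutativeRing coeff-isRingMonomorphism
        (CommutativeRing.isCommutativeRing ℤ⟦t⟧.powerSeriesRing)
    }

-- Words of unrestricted columns

-- An unrestricted column without a 1 (e) or with a 1 (u).  The head of a word is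
-- the rightmost column, i.e. the one of smallest label.
data Letter : Set where
  e u : Letter

Word : Set
Word = List Letter

-- `s` stands for t - 1. Keeping it as a separate element makes all identities free of subtraction,
-- within reach of a solver for commutative semirings.
module Transfer {c ℓ} (R : CommutativeRing c ℓ)
                (s t : CommutativeRing.Carrier R)
                (t≈1+s : CommutativeRing._≈_ R t (CommutativeRing._+_ R (CommutativeRing.1# R) s)) where
  open CommutativeRing R
  open PowerSeries rawRing using (_*ₛ_; R⟦x⟧)
  open RawSemiringDefs (RawRing.rawSemiring rawRing) using () renaming (_×_ to _·_)
  open SemiringSolver commutativeSemiring using (solve; _:+_; _:*_; _:=_; con)
  open ≈-Reasoning setoid

  risingFactorialᴿ : ℕ → Carrier
  risingFactorialᴿ zero    = 1#
  risingFactorialᴿ (suc n) = risingFactorialᴿ n * (t + n · 1#)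

  -- The evaluation e = 0, u = t: a final word containing e has a column without a 1, hence does not
  -- come from a permutation tableau.
  ev : Word → Carrier
  ev []      = 1#
  ev (u ∷ w) = t * ev w
  ev (e ∷ w) = 0#

  -- The sum of f over the words produced from a given one by a new top row with
  -- at least one 1: right of the leftmost 1, a 0 restricts its column, which must
  -- already contain a 1.
  nonzeroRows : (Word → Carrier) → Word → Carrier
  nonzeroRows f []      = 0#
  nonzeroRows f (u ∷ w) = f (u ∷ w) + nonzeroRows (f ∘ (u ∷_)) w + nonzeroRows f w
  nonzeroRows f (e ∷ w) = f (u ∷ w) + nonzeroRows (f ∘ (u ∷_)) w

  -- The transpose of adding one label, acting on functions of words instead of formal sums of
  -- words. The summands are a new column, a zero row and the nonzero rows.
  step : (Word → Carrier) → Word → Carrier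
  step f w = f (e ∷ w) + (f w + nonzeroRows f w)

  steps : ℕ → Word → Carrier
  steps zero    = ev
  steps (suc n) = step (steps n)

  -- f (y v w) = f y · ev (v w), in list order, for the formal combination v = u - e - 1.
  Splits : (Word → Carrier) → Set ℓ
  Splits f = ∀ y w → f (y ++ u ∷ w) ≈ f (y ++ e ∷ w) + f (y ++ w) + s * ev w * f y

  -- `ev` is multiplicative and sends v = u - e - 1 to t - 0 - 1 = `s`.
  ev-splits : Splits ev
  ev-splits []      w = begin
    t * ev w                        ≈⟨ *-congʳ t≈1+s ⟩
    (1# + s) * ev w                 ≈⟨ solve 2 (λ s a → (con 1 :+ s) :* a := con 0 :+ a :+ s :* a :* con 1)
                                         refl s (ev w) ⟩
    0# + ev w + s * ev w * 1#       ∎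
  ev-splits (u ∷ y) w = begin
    t * ev (y ++ u ∷ w)
      ≈⟨ *-congˡ (ev-splits y w) ⟩
    t * (ev (y ++ e ∷ w) + ev (y ++ w) + s * ev w * ev y)
      ≈⟨ solve 5 (λ t a b c d → t :* (a :+ b :+ c :* d) := t :* a :+ t :* b :+ c :* (t :* d)) refl
           t (ev (y ++ e ∷ w)) (ev (y ++ w)) (s * ev w) (ev y) ⟩
    t * ev (y ++ e ∷ w) + t * ev (y ++ w) + s * ev w * (t * ev y) ∎
  ev-splits (e ∷ y) w = solve 1 (λ a → con 0 := con 0 :+ con 0 :+ a :* con 0) refl (s * ev w)

  -- The heart is `y = []`: the clauses of `nonzeroRows` for u and e differ exactly by
  -- `nonzeroRows f w`, so v contributes 0. With `w` and `a` fixed, the hypothesis passes from `f`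
  -- to `f ∘ (u ∷_)`, as the induction on `y` requires.
  nonzeroRows-splits : ∀ {a} w f →
    (∀ y → f (y ++ u ∷ w) ≈ f (y ++ e ∷ w) + f (y ++ w) + a * f y) →
    ∀ y → nonzeroRows f (y ++ u ∷ w) ≈
          nonzeroRows f (y ++ e ∷ w) + nonzeroRows f (y ++ w) + a * nonzeroRows f y
  nonzeroRows-splits {a} w f f-splits []      =
    solve 2 (λ b a → b := b :+ a :* con 0) refl (nonzeroRows f (u ∷ w)) a
  nonzeroRows-splits {a} w f f-splits (u ∷ y) = begin
    _ ≈⟨ +-cong (+-cong (f-splits (u ∷ y)) (nonzeroRows-splits w (f ∘ (u ∷_)) (f-splits ∘ (u ∷_)) y))
           (nonzeroRows-splits w f f-splits y) ⟩
    _ ≈⟨ solve 10 (λ a x₁ x₂ x₃ y₁ y₂ y₃ z₁ z₂ z₃ →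
           (x₁ :+ x₂ :+ a :* x₃) :+ (y₁ :+ y₂ :+ a :* y₃) :+ (z₁ :+ z₂ :+ a :* z₃)
           := (x₁ :+ y₁ :+ z₁) :+ (x₂ :+ y₂ :+ z₂) :+ a :* (x₃ :+ y₃ :+ z₃)) refl a _ _ _ _ _ _ _ _ _ ⟩
    _ ∎
  nonzeroRows-splits {a} w f f-splits (e ∷ y) = begin
    _ ≈⟨ +-cong (f-splits (u ∷ y)) (nonzeroRows-splits w (f ∘ (u ∷_)) (f-splits ∘ (u ∷_)) y) ⟩
    _ ≈⟨ solve 7 (λ a x₁ x₂ x₃ y₁ y₂ y₃ →
           (x₁ :+ x₂ :+ a :* x₃) :+ (y₁ :+ y₂ :+ a :* y₃)
           := (x₁ :+ y₁) :+ (x₂ :+ y₂) :+ a :* (x₃ :+ y₃)) refl a _ _ _ _ _ _ ⟩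
    _ ∎

  -- The letter v shields the older columns `w` from all later steps: they enter only through
  -- `ev w`. Each summand of `step` preserves the splitting.
  steps-splits : ∀ n → Splits (steps n)
  steps-splits zero    = ev-splits
  steps-splits (suc n) y w = begin
    _ ≈⟨ +-cong (steps-splits n (e ∷ y) w) (+-cong (steps-splits n y w)
           (nonzeroRows-splits w (steps n) (λ z → steps-splits n z w) y)) ⟩
    _ ≈⟨ solve 10 (λ a x₁ x₂ x₃ y₁ y₂ y₃ z₁ z₂ z₃ →
           (x₁ :+ x₂ :+ a :* x₃) :+ ((y₁ :+ y₂ :+ a :* y₃) :+ (z₁ :+ z₂ :+ a :* z₃))
           := (x₁ :+ (y₁ :+ z₁)) :+ (x₂ :+ (y₂ :+ z₂)) :+ a :* (x₃ :+ (y₃ :+ z₃))) refl (s * ev w) _ _ _ _ _ _ _ _ _ ⟩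
    _ ∎

  nonzeroRows-linear : ∀ f a g w →
    nonzeroRows (λ w → f w + a * g w) w ≈ nonzeroRows f w + a * nonzeroRows g w
  nonzeroRows-linear f a g []      = solve 1 (λ a → con 0 := con 0 :+ a :* con 0) refl a
  nonzeroRows-linear f a g (u ∷ w) = begin
    _ ≈⟨ +-cong (+-congˡ (nonzeroRows-linear (f ∘ (u ∷_)) a (g ∘ (u ∷_)) w)) (nonzeroRows-linear f a g w) ⟩
    _ ≈⟨ solve 7 (λ a x₁ x₂ y₁ y₂ z₁ z₂ →
           (x₁ :+ a :* x₂) :+ (y₁ :+ a :* y₂) :+ (z₁ :+ a :* z₂)
           := (x₁ :+ y₁ :+ z₁) :+ a :* (x₂ :+ y₂ :+ z₂)) refl a _ _ _ _ _ _ ⟩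
    _ ∎
  nonzeroRows-linear f a g (e ∷ w) = begin
    _ ≈⟨ +-congˡ (nonzeroRows-linear (f ∘ (u ∷_)) a (g ∘ (u ∷_)) w) ⟩
    _ ≈⟨ solve 5 (λ a x₁ x₂ y₁ y₂ →
           (x₁ :+ a :* x₂) :+ (y₁ :+ a :* y₂) := (x₁ :+ y₁) :+ a :* (x₂ :+ y₂)) refl a _ _ _ _ ⟩
    _ ∎

  -- On powers of u this is dual to p(u) ↦ u p(u+1).
  raise : (Word → Carrier) → Word → Carrier
  raise f w = nonzeroRows f w + f (u ∷ w)

  -- Dual to multiplication by u + i.
  shift : ℕ → (Word → Carrier) → Word → Carrier
  shift i f w = f (u ∷ w) + i · 1# * f w

  -- f evaluated at u (u+1) ⋯ (u+i-1).
  rising : ℕ → (Word → Carrier) → Carrier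
  rising zero    f = f []
  rising (suc i) f = rising i (shift i f)

  -- The substitution of u + 1 for u inside `raise` turns the factor u + i into u + i + 1.
  shift-raise : ∀ i f w → shift i (raise f) w ≈ raise (shift (suc i) f) w
  shift-raise i f w = sym (begin
    _ ≈⟨ +-congʳ (nonzeroRows-linear (f ∘ (u ∷_)) (suc i · 1#) f w) ⟩
    _ ≈⟨ solve 5 (λ a x₁ x₂ y₁ y₂ → (x₁ :+ (con 1 :+ a) :* x₂) :+ (y₁ :+ (con 1 :+ a) :* y₂)
           := (y₂ :+ x₁ :+ x₂ :+ y₁) :+ a :* (x₂ :+ y₂)) refl
           (i · 1#) (nonzeroRows (f ∘ (u ∷_)) w) (nonzeroRows f w) (f (u ∷ u ∷ w)) (f (u ∷ w)) ⟩
    _ ∎)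

  rising-cong : ∀ i {f g} → (∀ w → f w ≈ g w) → rising i f ≈ rising i g
  rising-cong zero    f≈g = f≈g []
  rising-cong (suc i) f≈g = rising-cong i λ w → +-cong (f≈g (u ∷ w)) (*-congˡ (f≈g w))

  -- The map p(u) ↦ u p(u+1) takes u(u+1)⋯(u+i-1) to u(u+1)⋯(u+i).
  rising-raise : ∀ i f → rising i (raise f) ≈ rising (suc i) f
  rising-raise zero    f = solve 2 (λ x y → con 0 :+ x := x :+ con 0 :* y) refl (f (u ∷ [])) (f [])
  rising-raise (suc i) f = trans (rising-cong i (shift-raise i f)) (rising-raise i (shift (suc i) f))

  rising-+ : ∀ i f g → rising i (λ w → f w + g w) ≈ rising i f + rising i g
  rising-+ zero    f g = refl
  rising-+ (suc i) f g = trans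
    (rising-cong i λ w → solve 5 (λ a x₁ x₂ y₁ y₂ →
      (x₁ :+ x₂) :+ a :* (y₁ :+ y₂) := (x₁ :+ a :* y₁) :+ (x₂ :+ a :* y₂)) refl
      (i · 1#) (f (u ∷ w)) (g (u ∷ w)) (f w) (g w))
    (rising-+ i (shift i f) (shift i g))

  rising-* : ∀ i a f → rising i (λ w → a * f w) ≈ a * rising i f
  rising-* zero    a f = refl
  rising-* (suc i) a f = trans
    (rising-cong i λ w → solve 4 (λ b a x y →
      a :* x :+ b :* (a :* y) := a :* (x :+ b :* y)) refl
      (i · 1#) a (f (u ∷ w)) (f w))
    (rising-* i a (shift i f))

  rising-ev : ∀ i → rising i ev ≈ risingFactorialᴿ i
  rising-ev zero    = refl
  rising-ev (suc i) = begin
    rising i (shift i ev)                    ≈⟨ rising-cong i (λ w → distribʳ (ev w) t (i · 1#)) ⟨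
    rising i (λ w → (t + i · 1#) * ev w)     ≈⟨ rising-* i _ ev ⟩
    (t + i · 1#) * rising i ev               ≈⟨ *-congˡ (rising-ev i) ⟩
    (t + i · 1#) * risingFactorialᴿ i        ≈⟨ *-comm _ _ ⟩
    risingFactorialᴿ (suc i)                 ∎

  -- Here e is eliminated through e = u - 1 - v: by the splitting with empty `y`, the new column and
  -- the zero row together give `f (u ∷ w)` minus the contribution of v.
  steps-raise : ∀ n w → steps (suc n) w + s * steps n [] * ev w ≈ raise (steps n) w
  steps-raise n w = begin
    f (e ∷ w) + (f w + nonzeroRows f w) + s * f [] * ev w
      ≈⟨ solve 6 (λ a b c s x y → a :+ (b :+ c) :+ s :* x :* y := c :+ (a :+ b :+ s :* y :* x)) refl
           (f (e ∷ w)) (f w) (nonzeroRows f w) s (f []) (ev w) ⟩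
    nonzeroRows f w + (f (e ∷ w) + f w + s * ev w * f [])
      ≈⟨ +-congˡ (steps-splits n [] w) ⟨
    nonzeroRows f w + f (u ∷ w) ∎
    where
    f = steps n

  -- `steps-raise` evaluated at u(u+1)⋯(u+i-1): one step is traded for one more factor, and v splits
  -- off a product of a rising factorial and an earlier total.
  rising-steps : ∀ i n → rising i (steps (suc n)) + s * (risingFactorialᴿ i * steps n []) ≈ rising (suc i) (steps n)
  rising-steps i n = begin
    rising i (steps (suc n)) + s * (risingFactorialᴿ i * steps n [])
      ≈⟨ +-congˡ (solve 3 (λ s r x → s :* (r :* x) := s :* x :* r) refl s (risingFactorialᴿ i) (steps n [])) ⟩
    rising i (steps (suc n)) + s * steps n [] * risingFactorialᴿ i
      ≈⟨ +-congˡ (*-congˡ (rising-ev i)) ⟨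
    rising i (steps (suc n)) + s * steps n [] * rising i ev
      ≈⟨ +-congˡ (rising-* i _ ev) ⟨
    rising i (steps (suc n)) + rising i (λ w → s * steps n [] * ev w)
      ≈⟨ rising-+ i (steps (suc n)) _ ⟨
    rising i (λ w → steps (suc n) w + s * steps n [] * ev w)
      ≈⟨ rising-cong i (steps-raise n) ⟩
    rising i (raise (steps n))
      ≈⟨ rising-raise i (steps n) ⟩
    rising (suc i) (steps n) ∎

  total : ℕ → Carrier
  total n = steps n []

  -- Iterating `rising-steps` uses up the steps one by one, and the terms split off accumulate to
  -- the convolution. Each iteration raises `i`, so `i` must be general; the convolution without its
  -- first term is the one for `suc i`.
  rising-convolution : ∀ i n →
    rising i (steps (suc n)) + s * ((λ k → risingFactorialᴿ (k ℕ.+ i)) *ₛ total) n ≈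
    risingFactorialᴿ (suc n ℕ.+ i)
  rising-convolution i zero    = begin
    rising i (steps 1) + s * (risingFactorialᴿ i * total 0 + 0#)
      ≈⟨ +-congˡ (*-congˡ (+-identityʳ _)) ⟩
    rising i (steps 1) + s * (risingFactorialᴿ i * total 0)
      ≈⟨ rising-steps i 0 ⟩
    rising (suc i) ev
      ≈⟨ rising-ev (suc i) ⟩
    risingFactorialᴿ (suc i) ∎
  rising-convolution i (suc n) = begin
    rising i (steps (suc (suc n))) + s * (r * total (suc n) + C)
      ≈⟨ solve 4 (λ x s y z → x :+ s :* (y :+ z) := (x :+ s :* y) :+ s :* z) refl _ s (r * total (suc n)) C ⟩
    rising i (steps (suc (suc n))) + s * (r * total (suc n)) + s * C
      ≈⟨ +-cong (rising-steps i (suc n)) (*-congˡ (PowerSeriesRing.*ₛ-cong R {g = total}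
           (λ k → reflexive (≡.cong risingFactorialᴿ (≡.sym (ℕ.+-suc k i)))) (λ _ → refl) n)) ⟩
    rising (suc i) (steps (suc n)) + s * ((λ k → risingFactorialᴿ (k ℕ.+ suc i)) *ₛ total) n
      ≈⟨ rising-convolution (suc i) n ⟩
    risingFactorialᴿ (suc n ℕ.+ suc i)
      ≡⟨ ≡.cong risingFactorialᴿ (ℕ.+-suc (suc n) i) ⟩
    risingFactorialᴿ (suc (suc n) ℕ.+ i) ∎
    where
    r = risingFactorialᴿ i
    C = ((λ k → risingFactorialᴿ (suc k ℕ.+ i)) *ₛ total) n

  total-recurrence : ∀ n → total (suc n) + s * (risingFactorialᴿ *ₛ total) n ≈ risingFactorialᴿ (suc n)
  total-recurrence n = begin
    total (suc n) + s * (risingFactorialᴿ *ₛ total) n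
      ≈⟨ +-congˡ (*-congˡ (PowerSeriesRing.*ₛ-cong R {g = total}
           (λ k → reflexive (≡.cong risingFactorialᴿ (≡.sym (ℕ.+-identityʳ k)))) (λ _ → refl) n)) ⟩
    _ ≈⟨ rising-convolution 0 n ⟩
    risingFactorialᴿ (suc n ℕ.+ 0)
      ≡⟨ ≡.cong risingFactorialᴿ (ℕ.+-identityʳ (suc n)) ⟩
    risingFactorialᴿ (suc n) ∎

-- Elimination of the series of rising factorials

module Quotient {c ℓ} (R : CommutativeRing c ℓ)
                (s t : CommutativeRing.Carrier R)
                (t≈1+s : CommutativeRing._≈_ R t (CommutativeRing._+_ R (CommutativeRing.1# R) s)) where
  private
    module R = CommutativeRing R
    module P = PowerSeries R.rawRing
    module S = CommutativeRing (PowerSeriesRing.powerSeriesRing R)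
  open Transfer R s t t≈1+s
  open PowerSeriesRing R using (constant*x*-zero; constant*x*-suc)
  open RawRing P.R⟦x⟧ using (_≈_; _+_; _*_; 1#)
  open RawSemiringDefs (RawRing.rawSemiring R.rawRing) using () renaming (_×_ to _·_)
  private
    a : P.Series
    a = P.constant s * P.x

    RF : P.Series
    RF = risingFactorialᴿ

  total-equation : total + a * (RF * total) ≈ RF
  total-equation zero    = R.trans (R.+-congˡ (constant*x*-zero s (RF * total))) (R.+-identityʳ _)
  total-equation (suc n) = R.trans (R.+-congˡ (constant*x*-suc s (RF * total) n)) (total-recurrence n)

  module _ (E : P.Series) (E-zero : E 0 R.≈ R.0#)
           (E-suc : ∀ n → E (suc n) R.≈ suc n · risingFactorialᴿ n) where

    -- In degree n + 1 this is (n+1) (t)ₙ + (t-1) (t)ₙ = (t)ₙ (t+n).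
    E-equation : 1# + E + a * RF ≈ RF
    E-equation zero    = begin
      R.1# R.+ E 0 R.+ (a * RF) 0   ≈⟨ R.+-cong (R.+-congˡ E-zero) (constant*x*-zero s RF) ⟩
      R.1# R.+ R.0# R.+ R.0#        ≈⟨ R.trans (R.+-identityʳ _) (R.+-identityʳ _) ⟩
      R.1#                          ∎
      where open ≈-Reasoning R.setoid
    E-equation (suc n) = begin
      R.0# R.+ E (suc n) R.+ (a * RF) (suc n)
        ≈⟨ R.+-cong (R.trans (R.+-identityˡ _) (E-suc n)) (constant*x*-suc s RF n) ⟩
      r R.+ n · r R.+ s R.* r
        ≈⟨ R.+-congʳ (R.+-congˡ (×-*1 n)) ⟩
      r R.+ n · R.1# R.* r R.+ s R.* r
        ≈⟨ solve 3 (λ r n s → r :+ n :* r :+ s :* r := r :* (con 1 :+ s :+ n)) R.refl r (n · R.1#) s ⟩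
      r R.* (R.1# R.+ s R.+ n · R.1#)
        ≈⟨ R.*-congˡ (R.+-congʳ t≈1+s) ⟨
      risingFactorialᴿ (suc n) ∎
      where
      open ≈-Reasoning R.setoid
      open SemiringSolver R.commutativeSemiring using (solve; _:+_; _:*_; _:=_; con)
      r = risingFactorialᴿ n
      ×-*1 : ∀ n → n · r R.≈ n · R.1# R.* r
      ×-*1 zero    = R.sym (R.zeroˡ r)
      ×-*1 (suc n) = R.sym (R.trans (R.distribʳ r R.1# (n · R.1#)) (R.+-cong (R.*-identityˡ r) (R.sym (×-*1 n))))

    -- After a G + a² R G is added, either side reduces to R: the left by `E-equation` times a G and
    -- then `total-equation`, the right by `total-equation` times a and then `E-equation`.
    -- Cancelling the added term replaces a division by R.
    total*denominator : total * (1# + a * E) ≈ 1# + E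
    total*denominator = GroupProperties.∙-cancelʳ S.+-group (a * G + a * (a * (RF * G))) _ _ (begin
      G * (1# + a * E) + (a * G + a * (a * (RF * G)))
        ≈⟨ solve 4 (λ G E RF a → G :* (con 1 :+ a :* E) :+ (a :* G :+ a :* (a :* (RF :* G)))
             := G :+ a :* (con 1 :+ E :+ a :* RF) :* G) S.refl G E RF a ⟩
      G + a * (1# + E + a * RF) * G
        ≈⟨ S.+-congˡ {G} (S.*-congʳ {G} (S.*-congˡ {a} E-equation)) ⟩
      G + a * RF * G
        ≈⟨ S.+-congˡ {G} (S.*-assoc a RF G) ⟩
      G + a * (RF * G)
        ≈⟨ total-equation ⟩
      RF
        ≈⟨ E-equation ⟨
      1# + E + a * RF
        ≈⟨ S.+-congˡ {1# + E} (S.*-congˡ {a} total-equation) ⟨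
      1# + E + a * (G + a * (RF * G))
        ≈⟨ S.+-congˡ {1# + E} (S.distribˡ a G (a * (RF * G))) ⟩
      1# + E + (a * G + a * (a * (RF * G))) ∎)
      where
      open ≈-Reasoning S.setoid
      open SemiringSolver S.commutativeSemiring using (solve; _:+_; _:*_; _:=_; con)
      G = total

    total≈quotient : total ≈ (1# + E) P./ (1# + a * E)
    total≈quotient = begin
      total                  ≈⟨ S.*-identityʳ total ⟨
      total * 1#             ≈⟨ S.*-congˡ {total} (*-inverseʳ R.ring D D₀≈1) ⟨
      total * (D * D P.⁻¹)   ≈⟨ S.*-assoc total D (D P.⁻¹) ⟨
      total * D * D P.⁻¹     ≈⟨ S.*-congʳ {D P.⁻¹} total*denominator ⟩
      (1# + E) * D P.⁻¹      ∎
      where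
      open ≈-Reasoning S.setoid
      D = 1# + a * E
      D₀≈1 : D 0 R.≈ R.1#
      D₀≈1 = R.trans (R.+-congˡ (constant*x*-zero s E)) (R.+-identityʳ _)

-- Adding a top row

-- A restricted column leaves no letter: it stays restricted, and a 1 on top of it would turn the 0
-- that restricts it into a forbidden one.
letters : Bool → Bool → Word → Word
letters false h     = λ w → w
letters true  false = e ∷_
letters true  true  = u ∷_

word : ∀ {n} → (U H : Fin n → Bool) → Word
word {zero}  U H = []
word {suc n} U H = letters (U zero) (H zero) (word (U ∘ suc) (H ∘ suc))

word-cong : ∀ {n} {U U′ H H′ : Fin n → Bool} →
            (∀ c → U c ≡ U′ c) → (∀ c → H c ≡ H′ c) → word U H ≡ word U′ H′
word-cong {zero}  U≗ H≗ = ≡.refl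
word-cong {suc n} {U} {U′} {H} {H′} U≗ H≗
  rewrite U≗ zero | H≗ zero = ≡.cong (letters (U′ zero) (H′ zero)) (word-cong (U≗ ∘ suc) (H≗ ∘ suc))

-- U c and H c tell whether Column c is unrestricted and whether it contains a 1.
-- A row is a vector of entries by increasing label, so left row c asks for a 1 at
-- a larger index; unrestricted′ and hasOne′ update U and H for a new top row.
nonzero : ∀ {n} → Vec Bool n → Bool
nonzero []        = false
nonzero (b ∷ row) = b ∨ nonzero row

left : ∀ {n} → Vec Bool n → Fin n → Bool
left (b ∷ row) zero    = nonzero row
left (b ∷ row) (suc c) = left row c

unrestricted′ : ∀ {n} → (Fin n → Bool) → Vec Bool n → Fin n → Bool
unrestricted′ U row c = U c ∧ (lookup row c ∨ not (left row c))

hasOne′ : ∀ {n} → (Fin n → Bool) → Vec Bool n → Fin n → Bool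
hasOne′ H row c = lookup row c ∨ H c

-- A 1 may only be put on an unrestricted column. A 0 with a 1 to its left, that is, at a larger
-- index, restricts its column for good, so a column that was unrestricted must already contain a 1.
compatible : ∀ {n} → (U H : Fin n → Bool) → Vec Bool n → Bool
compatible U H []        = true
compatible U H (b ∷ row) =
  (if b then U zero else not (U zero ∧ nonzero row) ∨ H zero) ∧ compatible (U ∘ suc) (H ∘ suc) row

-- When the new label is a column there is no new row of cells, so its line of the filling must be
-- zero.
admissible : ∀ {n} → Step → (U H : Fin n → Bool) → Vec Bool n → Bool
admissible south U H row = compatible U H row
admissible west  U H row = not (nonzero row)

zeroRow-compatible : ∀ {n} (U H : Fin n → Bool) row → nonzero row ≡ false → compatible U H row ≡ true
zeroRow-compatible U H []            eq = ≡.refl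
zeroRow-compatible U H (false ∷ row) eq rewrite eq with U zero
... | true  = zeroRow-compatible (U ∘ suc) (H ∘ suc) row eq
... | false = zeroRow-compatible (U ∘ suc) (H ∘ suc) row eq

-- Finite sums with Boolean conditions

subsets : ∀ n → List (Vec Bool n)
subsets = allVecs (false ∷ true ∷ [])

module ListSum {c ℓ} (R : CommutativeRing c ℓ) where
  open CommutativeRing R hiding (zero)
  open CommutativeSemigroup +-commutativeSemigroup using () renaming (interchange to +-interchange)
  open ≈-Reasoning setoid

  infixr 8 _⊙_
  -- Multiplication by an Iverson bracket.
  _⊙_ : Bool → Carrier → Carrier
  true  ⊙ a = a
  false ⊙ a = 0#

  ⊙-yes : ∀ {P : Set} (P? : Dec P) {a} → P → does P? ⊙ a ≡ a
  ⊙-yes P? p = ≡.cong (_⊙ _) (dec-true P? p)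

  ⊙-no : ∀ {P : Set} (P? : Dec P) {a} → ¬ P → does P? ⊙ a ≡ 0#
  ⊙-no P? ¬p = ≡.cong (_⊙ _) (dec-false P? ¬p)

  ⊙-cong : ∀ b {a a′} → (b ≡ true → a ≈ a′) → b ⊙ a ≈ b ⊙ a′
  ⊙-cong true  a≈a′ = a≈a′ ≡.refl
  ⊙-cong false a≈a′ = refl

  ⊙-∧ : ∀ b b′ {a} → (b ∧ b′) ⊙ a ≡ b ⊙ (b′ ⊙ a)
  ⊙-∧ true  b′ = ≡.refl
  ⊙-∧ false b′ = ≡.refl

  ⊙-+ : ∀ b {a a′} → b ⊙ a + b ⊙ a′ ≈ b ⊙ (a + a′)
  ⊙-+ true  = refl
  ⊙-+ false = +-identityʳ 0#

  ⊙-split : ∀ b {a} → a ≈ not b ⊙ a + b ⊙ a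
  ⊙-split true  = sym (+-identityˡ _)
  ⊙-split false = sym (+-identityʳ _)

  ∑ : ∀ {A : Set} → List A → (A → Carrier) → Carrier
  ∑ xs f = foldr _+_ 0# (map f xs)

  infixl 5 ∑
  syntax ∑ xs (λ x → a) = ∑[ x ∈ xs ] a

  private variable
    A B C : Set

  ∑-cong : ∀ (xs : List A) {f g : A → Carrier} → (∀ x → f x ≈ g x) → ∑ xs f ≈ ∑ xs g
  ∑-cong []       f≈g = refl
  ∑-cong (x ∷ xs) f≈g = +-cong (f≈g x) (∑-cong xs f≈g)

  ∑-zero : ∀ (xs : List A) → ∑[ x ∈ xs ] 0# ≈ 0#
  ∑-zero []       = refl
  ∑-zero (x ∷ xs) = trans (+-identityˡ _) (∑-zero xs)

  ∑-vanishes : ∀ (xs : List A) {f} → (∀ x → f x ≈ 0#) → ∑ xs f ≈ 0#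
  ∑-vanishes xs f≈0 = trans (∑-cong xs f≈0) (∑-zero xs)

  ∑-+ : ∀ (xs : List A) f g → ∑[ x ∈ xs ] (f x + g x) ≈ ∑ xs f + ∑ xs g
  ∑-+ []       f g = sym (+-identityʳ 0#)
  ∑-+ (x ∷ xs) f g = trans (+-congˡ (∑-+ xs f g)) (+-interchange _ _ _ _)

  ∑-⊙ : ∀ (xs : List A) b f → ∑[ x ∈ xs ] b ⊙ f x ≈ b ⊙ ∑ xs f
  ∑-⊙ xs true  f = refl
  ∑-⊙ xs false f = ∑-zero xs

  ∑-comm : ∀ (xs : List A) (ys : List B) (f : A → B → Carrier) →
    ∑[ x ∈ xs ] ∑[ y ∈ ys ] f x y ≈ ∑[ y ∈ ys ] ∑[ x ∈ xs ] f x y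
  ∑-comm []       ys f = sym (∑-zero ys)
  ∑-comm (x ∷ xs) ys f = trans (+-congˡ (∑-comm xs ys f)) (sym (∑-+ ys (f x) _))

  ∑-++ : ∀ (xs ys : List A) f → ∑ (xs ++ ys) f ≈ ∑ xs f + ∑ ys f
  ∑-++ []       ys f = sym (+-identityˡ _)
  ∑-++ (x ∷ xs) ys f = trans (+-congˡ (∑-++ xs ys f)) (sym (+-assoc _ _ _))

  ∑-map : ∀ (g : A → B) xs f → ∑ (map g xs) f ≡ ∑ xs (f ∘ g)
  ∑-map g []       f = ≡.refl
  ∑-map g (x ∷ xs) f = ≡.cong (f (g x) +_) (∑-map g xs f)

  ∑-cartesianProductWith : ∀ (g : A → B → C) xs ys f →
    ∑ (cartesianProductWith g xs ys) f ≈ ∑[ x ∈ xs ] ∑[ y ∈ ys ] f (g x y)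
  ∑-cartesianProductWith g []       ys f = refl
  ∑-cartesianProductWith g (x ∷ xs) ys f = trans (∑-++ (map (g x) ys) _ f)
    (+-cong (reflexive (∑-map (g x) ys f)) (∑-cartesianProductWith g xs ys f))

  ∑-filter : ∀ {P : A → Set} (P? : Decidable P) f xs → ∑ (filter P? xs) f ≈ ∑[ x ∈ xs ] does (P? x) ⊙ f x
  ∑-filter P? f []       = refl
  ∑-filter P? f (x ∷ xs) with does (P? x)
  ... | true  = +-congˡ (∑-filter P? f xs)
  ... | false = trans (∑-filter P? f xs) (sym (+-identityˡ _))

  ∑-subsets : ∀ n f → ∑ (subsets (suc n)) f ≈
              (∑[ row ∈ subsets n ] f (false ∷ row)) + (∑[ row ∈ subsets n ] f (true ∷ row))
  ∑-subsets n f = trans (∑-cartesianProductWith _∷_ (false ∷ true ∷ []) (subsets n) f)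
    (+-congˡ (+-identityʳ _))

-- Summation over the possible top rows

module RowSum {c ℓ} (R : CommutativeRing c ℓ)
                (s t : CommutativeRing.Carrier R)
                (t≈1+s : CommutativeRing._≈_ R t (CommutativeRing._+_ R (CommutativeRing.1# R) s)) where
  open CommutativeRing R hiding (zero)
  open Transfer R s t t≈1+s
  open ListSum R
  open ≈-Reasoning setoid

  private
    after : ∀ {n} → (U H : Fin n → Bool) → Vec Bool n → Word
    after U H row = word (unrestricted′ U row) (hasOne′ H row)

  -- Only the zero row survives, and it changes no column. The induction absorbs the first letter
  -- into `f`, which is therefore arbitrary.
  ∑-zeroRow : ∀ {n} (U H : Fin n → Bool) (f : Word → Carrier) →
    ∑[ row ∈ subsets n ] not (nonzero row) ⊙ f (after U H row) ≈ f (word U H)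
  ∑-zeroRow {zero}  U H f = +-identityʳ _
  ∑-zeroRow {suc n} U H f = begin
    _ ≈⟨ ∑-subsets n _ ⟩
    _ ≈⟨ +-cong (∑-cong (subsets n) drop) (∑-zero (subsets n)) ⟩
    _ ≈⟨ +-identityʳ _ ⟩
    _ ≈⟨ ∑-zeroRow (U ∘ suc) (H ∘ suc) (f ∘ letters (U zero) (H zero)) ⟩
    f (word U H) ∎
    where
    drop : ∀ row → not (nonzero row) ⊙ f (after U H (false ∷ row)) ≈
             not (nonzero row) ⊙ f (letters (U zero) (H zero) (after (U ∘ suc) (H ∘ suc) row))
    drop row with nonzero row | U zero
    ... | true  | _     = refl
    ... | false | true  = refl
    ... | false | false = refl

  ∑-compatible-zeroRow : ∀ {n} (U H : Fin n → Bool) (f : Word → Carrier) →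
    ∑[ row ∈ subsets n ] not (nonzero row) ⊙ compatible U H row ⊙ f (after U H row) ≈ f (word U H)
  ∑-compatible-zeroRow U H f = trans (∑-cong (subsets _) drop) (∑-zeroRow U H f)
    where
    drop : ∀ row → not (nonzero row) ⊙ compatible U H row ⊙ f (after U H row) ≈
                   not (nonzero row) ⊙ f (after U H row)
    drop row with nonzero row in eq
    ... | true  = refl
    ... | false rewrite zeroRow-compatible U H row eq = refl

  ∑-compatible-split : ∀ {n} (U H : Fin n → Bool) (f : Word → Carrier) →
    ∑[ row ∈ subsets n ] compatible U H row ⊙ f (after U H row) ≈
    f (word U H) + (∑[ row ∈ subsets n ] nonzero row ⊙ compatible U H row ⊙ f (after U H row))
  ∑-compatible-split {n} U H f = begin
    _ ≈⟨ ∑-cong (subsets n) (λ row → ⊙-split (nonzero row)) ⟩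
    _ ≈⟨ ∑-+ (subsets n) _ _ ⟩
    _ ≈⟨ +-congʳ (∑-compatible-zeroRow U H f) ⟩
    _ ∎

  -- The recursion of `nonzeroRows`, read off the first entry. A 1 needs an unrestricted column and
  -- makes its letter u, with the remaining entries zero or not. A 0 has a 1 to its left: it is
  -- harmless on a restricted column, excluded on a letter e, and deletes a letter u.
  ∑-nonzeroRow : ∀ {n} (U H : Fin n → Bool) (f : Word → Carrier) →
    ∑[ row ∈ subsets n ] nonzero row ⊙ compatible U H row ⊙ f (after U H row) ≈ nonzeroRows f (word U H)
  ∑-nonzeroRow {zero}  U H f = +-identityʳ _
  ∑-nonzeroRow {suc n} U H f = trans (∑-subsets n _) (cases (U zero) (H zero) ≡.refl ≡.refl)
    where
    rows = subsets n
    U⁺ = U ∘ suc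
    H⁺ = H ∘ suc
    w = word U⁺ H⁺

    Goal = (∑[ row ∈ rows ] nonzero row ⊙ compatible U H (false ∷ row) ⊙ f (after U H (false ∷ row)))
             + (∑[ row ∈ rows ] compatible U H (true ∷ row) ⊙ f (after U H (true ∷ row)))
             ≈ nonzeroRows f (word U H)

    zero-entry : U zero ≡ false →
      (∑[ row ∈ rows ] nonzero row ⊙ compatible U H (false ∷ row) ⊙ f (after U H (false ∷ row))) ≈
      nonzeroRows f w
    zero-entry eq rewrite eq = ∑-nonzeroRow U⁺ H⁺ f

    one-entry : U zero ≡ true →
      (∑[ row ∈ rows ] compatible U H (true ∷ row) ⊙ f (after U H (true ∷ row))) ≈
      f (u ∷ w) + nonzeroRows (f ∘ (u ∷_)) w
    one-entry eq rewrite eq = trans (∑-compatible-split U⁺ H⁺ (f ∘ (u ∷_)))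
      (+-congˡ (∑-nonzeroRow U⁺ H⁺ (f ∘ (u ∷_))))

    cases : ∀ b h → U zero ≡ b → H zero ≡ h → Goal
    cases false h U₀ H₀ = begin
      _ ≈⟨ +-cong (zero-entry U₀) (∑-vanishes rows no-one) ⟩
      nonzeroRows f w + 0#      ≈⟨ +-identityʳ _ ⟩
      nonzeroRows f w           ≡⟨ ≡.cong (λ b → nonzeroRows f (letters b (H zero) w)) U₀ ⟨
      nonzeroRows f (word U H)  ∎
      where
      no-one : ∀ row → compatible U H (true ∷ row) ⊙ f (after U H (true ∷ row)) ≈ 0#
      no-one row rewrite U₀ = refl
    cases true false U₀ H₀ = begin
      _ ≈⟨ +-cong (∑-vanishes rows no-zero) (one-entry U₀) ⟩
      0# + (f (u ∷ w) + nonzeroRows (f ∘ (u ∷_)) w) ≈⟨ +-identityˡ _ ⟩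
      f (u ∷ w) + nonzeroRows (f ∘ (u ∷_)) w        ≡⟨ ≡.cong₂ (λ b h → nonzeroRows f (letters b h w)) U₀ H₀ ⟨
      nonzeroRows f (word U H)  ∎
      where
      no-zero : ∀ row → nonzero row ⊙ compatible U H (false ∷ row) ⊙ f (after U H (false ∷ row)) ≈ 0#
      no-zero row with nonzero row
      ... | false = refl
      ... | true rewrite U₀ | H₀ = refl
    cases true true U₀ H₀ = begin
      _ ≈⟨ +-cong (∑-cong rows drop) (one-entry U₀) ⟩
      _ ≈⟨ +-congʳ (∑-nonzeroRow U⁺ H⁺ f) ⟩
      nonzeroRows f w + (f (u ∷ w) + nonzeroRows (f ∘ (u ∷_)) w) ≈⟨ +-comm _ _ ⟩
      f (u ∷ w) + nonzeroRows (f ∘ (u ∷_)) w + nonzeroRows f w   ≡⟨ ≡.cong₂ (λ b h → nonzeroRows f (letters b h w)) U₀ H₀ ⟨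
      nonzeroRows f (word U H)  ∎
      where
      drop : ∀ row → nonzero row ⊙ compatible U H (false ∷ row) ⊙ f (after U H (false ∷ row)) ≈
                     nonzero row ⊙ compatible U⁺ H⁺ row ⊙ f (after U⁺ H⁺ row)
      drop row with nonzero row
      ... | false = refl
      ... | true rewrite U₀ | H₀ = refl

  ∑-compatible : ∀ {n} (U H : Fin n → Bool) (f : Word → Carrier) →
    ∑[ row ∈ subsets n ] compatible U H row ⊙ f (after U H row) ≈ f (word U H) + nonzeroRows f (word U H)
  ∑-compatible U H f = trans (∑-compatible-split U H f) (+-congˡ (∑-nonzeroRow U H f))

-- Prepending a label to a tableau

≡-via-true : ∀ {a b} → (a ≡ true → b ≡ true) → (b ≡ true → a ≡ true) → a ≡ b
≡-via-true {true}          a⇒b b⇒a = ≡.sym (a⇒b ≡.refl)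
≡-via-true {false} {true}  a⇒b b⇒a = b⇒a ≡.refl
≡-via-true {false} {false} a⇒b b⇒a = ≡.refl

∧-trueˡ : ∀ a b → a ∧ b ≡ true → a ≡ true
∧-trueˡ true b eq = ≡.refl

∧-trueʳ : ∀ a b → a ∧ b ≡ true → b ≡ true
∧-trueʳ true b eq = eq

isWest : Step → Bool
isWest south = false
isWest west  = true

does⁻ : ∀ {P : Set} (P? : Dec P) → does P? ≡ true → P
does⁻ (yes p) _ = p

module _ {n} (T : Tableau n) where
  open Tableau T

  HasOne Restricted : Fin n → Set
  HasOne     c = ∃[ r ] One T r c
  Restricted c = ∃[ r ] Zero T r c × OneToTheLeft T r c

  hasOne? : ∀ c → Dec (HasOne c)
  hasOne? c = any? λ r → one? T r c

  restricted? : ∀ c → Dec (Restricted c)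
  restricted? c = any? λ r → zero? T r c ×-dec oneToTheLeft? T r c

  -- The permutation tableau axioms, except that a column without a 1 is allowed as
  -- long as it is unrestricted, so that rows added on top can still put a 1 in it.
  record IsExtendable : Set where
    field
      ones-in-cells      : ∀ r c → One T r c → Cell diagram r c
      no-bad-0           : ∀ r c → ¬ (Zero T r c × OneAbove T r c × OneToTheLeft T r c)
      restricted-has-one : ∀ c → Restricted c → HasOne c

  isExtendable? : Dec IsExtendable
  isExtendable? = map′
    (λ (p , q , h) → record { ones-in-cells = p ; no-bad-0 = q ; restricted-has-one = h })
    (λ P → let open IsExtendable P in ones-in-cells , no-bad-0 , restricted-has-one)
    ((all? λ r → all? λ c → one? T r c →-dec cell? diagram r c)
      ×-dec (all? λ r → all? λ c → ¬? (zero? T r c ×-dec oneAbove? T r c ×-dec oneToTheLeft? T r c))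
      ×-dec (all? λ c → restricted? c →-dec hasOne? c))

  isUnrestricted hasOne : Fin n → Bool
  isUnrestricted c = does (unrestrictedColumn? T c)
  hasOne         c = does (hasOne? c)

OneLeftOf : ∀ {n} → Subset n → Fin n → Set
OneLeftOf row c = ∃[ c′ ] c < c′ × c′ ∈ row

nonzero⇔ : ∀ {n} (row : Subset n) → nonzero row ≡ true ⇔ (∃[ c ] c ∈ row)
nonzero⇔ []            = mk⇔ (λ ()) (λ ())
nonzero⇔ (true  ∷ row) = mk⇔ (λ _ → zero , here) (λ _ → ≡.refl)
nonzero⇔ (false ∷ row) = mk⇔
  (λ eq → let c , c∈row = to (nonzero⇔ row) eq in suc c , there c∈row)
  (λ { (suc c , there c∈row) → from (nonzero⇔ row) (c , c∈row) })

left⇔ : ∀ {n} (row : Subset n) c → left row c ≡ true ⇔ OneLeftOf row c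
left⇔ (b ∷ row) zero    = mk⇔
  (λ eq → let c , c∈row = to (nonzero⇔ row) eq in suc c , z<s , there c∈row)
  (λ { (suc c , _ , there c∈row) → from (nonzero⇔ row) (c , c∈row) })
left⇔ (b ∷ row) (suc c) = mk⇔
  (λ eq → let c′ , c<c′ , c′∈row = to (left⇔ row c) eq in suc c′ , s<s c<c′ , there c′∈row)
  (λ { (suc c′ , s<s c<c′ , there c′∈row) → from (left⇔ row c) (c′ , c<c′ , c′∈row) })

compatible⇔ : ∀ {n} (U H : Fin n → Bool) row → compatible U H row ≡ true ⇔
  (∀ c → (if lookup row c then U c else not (U c ∧ left row c) ∨ H c) ≡ true)
compatible⇔ U H []        = mk⇔ (λ _ ()) (λ _ → ≡.refl)
compatible⇔ U H (b ∷ row) = mk⇔ ⇒ ⇐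
  where
  IH = compatible⇔ (U ∘ suc) (H ∘ suc) row
  ⇒ : compatible U H (b ∷ row) ≡ true → _
  ⇒ eq c with if b then U zero else not (U zero ∧ nonzero row) ∨ H zero in eq₀
  ⇒ eq zero    | true = eq₀
  ⇒ eq (suc c) | true = to IH eq c
  ⇐ : _ → compatible U H (b ∷ row) ≡ true
  ⇐ all = ≡.cong₂ _∧_ (all zero) (from IH (all ∘ suc))

-- No label is smaller than the new one, so a column with this label has no cells: hence the `false`
-- in front of every line. Both kinds of step share this form; for `west`, admissibility makes `row`
-- zero.
prepend : ∀ {n} → Step → Subset n → Tableau n → Tableau (suc n)
prepend s row (tableau D F) = tableau (s ∷ D) ((false ∷ row) ∷ Vec.map (false ∷_) F)

module Prepend {n} (s : Step) (row : Subset n) (T : Tableau n) where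
  open Tableau T renaming (diagram to D; ones to F)

  private
    T⁺ : Tableau (suc n)
    T⁺ = prepend s row T

  one-suc : ∀ {r c} → One T⁺ (suc r) (suc c) ⇔ One T r c
  one-suc {r} {c} = mk⇔
    (drop-there ∘ ≡.subst (suc c ∈_) (lookup-map r (false ∷_) F))
    (≡.subst (suc c ∈_) (≡.sym (lookup-map r (false ∷_) F)) ∘ there)

  ¬one-zero : ∀ {r} → ¬ One T⁺ r zero
  ¬one-zero {zero}  ()
  ¬one-zero {suc r} o with () ← ≡.subst (zero ∈_) (lookup-map r (false ∷_) F) o

  cell-suc : ∀ {r c} → Cell (s ∷ D) (suc r) (suc c) ⇔ Cell D r c
  cell-suc = mk⇔ (λ { (i , j , s<s r<c) → i , j , r<c }) (λ (i , j , r<c) → i , j , s<s r<c)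

  zero-suc : ∀ {r c} → Zero T⁺ (suc r) (suc c) ⇔ Zero T r c
  zero-suc = mk⇔ (λ (x , ¬o) → to cell-suc x , ¬o ∘ from one-suc)
                 (λ (x , ¬o) → from cell-suc x , ¬o ∘ to one-suc)

  oneToTheLeft-zero : ∀ {c} → OneToTheLeft T⁺ zero (suc c) ⇔ OneLeftOf row c
  oneToTheLeft-zero = mk⇔ (λ { (suc c′ , s<s c<c′ , there o) → c′ , c<c′ , o })
                          (λ (c′ , c<c′ , o) → suc c′ , s<s c<c′ , there o)

  oneToTheLeft-suc : ∀ {r c} → OneToTheLeft T⁺ (suc r) (suc c) ⇔ OneToTheLeft T r c
  oneToTheLeft-suc = mk⇔ (λ { (suc c′ , s<s c<c′ , o) → c′ , c<c′ , to one-suc o })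
                         (λ (c′ , c<c′ , o) → suc c′ , s<s c<c′ , from one-suc o)

  oneAbove-suc : ∀ {r c} → OneAbove T⁺ (suc r) (suc c) ⇔ (c ∈ row ⊎ OneAbove T r c)
  oneAbove-suc = mk⇔
    (λ { (zero , _ , there o) → inj₁ o ; (suc r′ , s<s r′<r , o) → inj₂ (r′ , r′<r , to one-suc o) })
    [ (λ o → zero , z<s , there o) , (λ (r′ , r′<r , o) → suc r′ , s<s r′<r , from one-suc o) ]′

  hasOne-suc : ∀ {c} → HasOne T⁺ (suc c) ⇔ (c ∈ row ⊎ HasOne T c)
  hasOne-suc = mk⇔
    (λ { (zero , there o) → inj₁ o ; (suc r , o) → inj₂ (r , to one-suc o) })
    [ (λ o → zero , there o) , (λ (r , o) → suc r , from one-suc o) ]′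

  restricted-suc : ∀ {c} → Restricted T⁺ (suc c) ⇔
    ((s ≡ south × IsColumn D c × c ∉ row × OneLeftOf row c) ⊎ Restricted T c)
  restricted-suc = mk⇔
    (λ { (zero , ((s≡ , col , _) , ¬o) , l) → inj₁ (s≡ , col , ¬o ∘ there , to oneToTheLeft-zero l)
       ; (suc r , z , l) → inj₂ (r , to zero-suc z , to oneToTheLeft-suc l) })
    [ (λ (s≡ , col , ¬o , l) → zero , ((s≡ , col , z<s) , ¬o ∘ drop-there) , from oneToTheLeft-zero l)
    , (λ (r , z , l) → suc r , from zero-suc z , from oneToTheLeft-suc l) ]′

  -- The propositional form of `admissible`, for both steps at once: for `west` the first clause
  -- forces `row` to be empty.
  Compatible : Set
  Compatible = ∀ c → (c ∈ row → s ≡ south × UnrestrictedColumn T c)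
                   × (UnrestrictedColumn T c → c ∉ row → OneLeftOf row c → HasOne T c)

  extendable⁻ : IsExtendable T⁺ → IsExtendable T × Compatible
  extendable⁻ P = extendable , compat
    where
    open IsExtendable P

    compat₁ : ∀ c → c ∈ row → s ≡ south × UnrestrictedColumn T c
    compat₁ c c∈row with ones-in-cells zero (suc c) (there c∈row)
    -- If the column were restricted in `T`, the new 1 would lie above a 0 that has a 1 to its left.
    ... | s≡ , col , _ = s≡ , col , λ (r , z , l) →
      no-bad-0 (suc r) (suc c) (from zero-suc z , from oneAbove-suc (inj₁ c∈row) , from oneToTheLeft-suc l)

    compat : Compatible
    -- The new 0 restricts Column c, which must therefore contain a 1, necessarily below the new
    -- row. The 1 at c′ supplies `s ≡ south`.
    compat c = compat₁ c , λ (col , _) c∉row l@(c′ , _ , c′∈row) →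
      [ (λ c∈row → ⊥-elim (c∉row c∈row)) , (λ h → h) ]′ (to hasOne-suc (restricted-has-one (suc c)
        (from restricted-suc (inj₁ (proj₁ (compat₁ c′ c′∈row) , col , c∉row , l)))))

    extendable : IsExtendable T
    extendable = record
      { ones-in-cells = λ r c o → to cell-suc (ones-in-cells (suc r) (suc c) (from one-suc o))
      ; no-bad-0 = λ r c (z , a , l) → no-bad-0 (suc r) (suc c)
          (from zero-suc z , from oneAbove-suc (inj₂ a) , from oneToTheLeft-suc l)
      ; restricted-has-one = λ c x →
          [ (λ c∈row → ⊥-elim (proj₂ (proj₂ (compat₁ c c∈row)) x)) , (λ h → h) ]′
            (to hasOne-suc (restricted-has-one (suc c) (from restricted-suc (inj₂ x))))
      }

  extendable⁺ : IsExtendable T → Compatible → IsExtendable T⁺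
  extendable⁺ P compat = record
    { ones-in-cells = λ where
        r       zero    o         → ⊥-elim (¬one-zero {r} o)
        zero    (suc c) (there o) → let s≡ , col , _ = proj₁ (compat c) o in s≡ , col , z<s
        (suc r) (suc c) o         → from cell-suc (ones-in-cells r c (to one-suc o))
    ; no-bad-0 = λ where
        r       zero    (((_ , _ , ()) , _) , _)
        zero    (suc c) (_ , (_ , () , _) , _)
        (suc r) (suc c) (z , a , l) →
          [ (λ c∈row → proj₂ (proj₂ (proj₁ (compat c) c∈row)) (r , to zero-suc z , to oneToTheLeft-suc l))
          , (λ a → no-bad-0 r c (to zero-suc z , a , to oneToTheLeft-suc l)) ]′ (to oneAbove-suc a)
    ; restricted-has-one = λ where
        zero    (_ , ((_ , _ , ()) , _) , _)
        (suc c) x → from hasOne-suc (inj₂ ([ new c , restricted-has-one c ]′ (to restricted-suc x)))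
    }
    where
    open IsExtendable P
    new : ∀ c → s ≡ south × IsColumn D c × c ∉ row × OneLeftOf row c → HasOne T c
    -- `Compatible` only speaks of columns unrestricted in `T`; one already restricted has its 1 by
    -- extendability.
    new c (_ , col , c∉row , l) with restricted? T c
    ... | yes x = restricted-has-one c x
    ... | no ¬x = proj₂ (compat c) (col , ¬x) c∉row l

  unrestricted-suc : Compatible → ∀ {c} → UnrestrictedColumn T⁺ (suc c) ⇔
                     (UnrestrictedColumn T c × (c ∈ row ⊎ ¬ OneLeftOf row c))
  unrestricted-suc compat {c} = mk⇔ ⇒ ⇐
    where
    ⇒ : _ → _
    ⇒ (col , ¬x) = (col , ¬x ∘ from restricted-suc ∘ inj₂) , in-or-left
      where
      in-or-left : c ∈ row ⊎ ¬ OneLeftOf row c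
      in-or-left with lookup row c in eq
      ... | true  = inj₁ (lookup⇒[]= c row eq)
      ... | false = inj₂ λ l@(c′ , _ , c′∈row) → ¬x (from restricted-suc (inj₁
        (proj₁ (proj₁ (compat c′) c′∈row) , col , (λ c∈row → not-¬ eq ([]=⇒lookup c∈row)) , l)))
    ⇐ : _ → _
    ⇐ ((col , ¬x) , inj₁ c∈row) = col , [ (λ (_ , _ , c∉row , _) → c∉row c∈row) , ¬x ]′ ∘ to restricted-suc
    ⇐ ((col , ¬x) , inj₂ ¬l)    = col , [ (λ (_ , _ , _ , l) → ¬l l) , ¬x ]′ ∘ to restricted-suc

  private
    U H : Fin n → Bool
    U = isUnrestricted T
    H = hasOne T

  admissible⇔ : admissible s U H row ≡ true ⇔ Compatible
  admissible⇔ = mk⇔ (⇒ s ≡.refl) (⇐ s ≡.refl)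
    where
    ⇒ : ∀ s′ → s ≡ s′ → admissible s′ U H row ≡ true → Compatible
    ⇒ west  s≡ eq c = (λ c∈row → ⊥-elim (empty (c , c∈row)))
                    , (λ _ _ (c′ , _ , c′∈row) → ⊥-elim (empty (c′ , c′∈row)))
      where
      empty : ¬ (∃[ c ] c ∈ row)
      empty x = not-¬ eq (≡.cong not (from (nonzero⇔ row) x))
    ⇒ south s≡ eq c with lookup row c in b | to (compatible⇔ U H row) eq c
    ... | true  | Uc = (λ _ → s≡ , does⁻ (unrestrictedColumn? T c) Uc)
                     , λ _ c∉row _ → ⊥-elim (c∉row (lookup⇒[]= c row b))
    ... | false | ok = (λ c∈row → ⊥-elim (not-¬ b ([]=⇒lookup c∈row)))
                     , λ unr _ l → does⁻ (hasOne? T c) (≡.trans (≡.sym (≡.cong (λ b → not b ∨ H c)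
                         (≡.cong₂ _∧_ (dec-true (unrestrictedColumn? T c) unr) (from (left⇔ row c) l)))) ok)

    ⇐ : ∀ s′ → s ≡ s′ → Compatible → admissible s′ U H row ≡ true
    ⇐ west  ≡.refl compat with nonzero row in eq
    ... | false = ≡.refl
    ... | true  with c , c∈row ← to (nonzero⇔ row) eq with () ← proj₁ (proj₁ (compat c) c∈row)
    ⇐ south ≡.refl compat = from (compatible⇔ U H row) ok
      where
      ok : ∀ c → (if lookup row c then U c else not (U c ∧ left row c) ∨ H c) ≡ true
      ok c with lookup row c in b
      ... | true = dec-true (unrestrictedColumn? T c) (proj₂ (proj₁ (compat c) (lookup⇒[]= c row b)))
      ... | false with U c in Uc | left row c in l
      ...   | false | _     = ≡.refl
      ...   | true  | false = ≡.refl
      ...   | true  | true  = dec-true (hasOne? T c) (proj₂ (compat c) (does⁻ (unrestrictedColumn? T c) Uc)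
                                (λ c∈row → not-¬ b ([]=⇒lookup c∈row)) (to (left⇔ row c) l))

  isExtendable-prepend : does (isExtendable? T⁺) ≡ does (isExtendable? T) ∧ admissible s U H row
  isExtendable-prepend = ≡-via-true
    (λ eq → let P , compat = extendable⁻ (does⁻ (isExtendable? T⁺) eq) in
      ≡.cong₂ _∧_ (dec-true (isExtendable? T) P) (from admissible⇔ compat))
    (λ eq → dec-true (isExtendable? T⁺) (extendable⁺
      (does⁻ (isExtendable? T) (∧-trueˡ _ _ eq)) (to admissible⇔ (∧-trueʳ _ _ eq))))

  hasOne-prepend : ∀ c → hasOne T⁺ (suc c) ≡ hasOne′ H row c
  hasOne-prepend c = ≡-via-true ⇒ ⇐
    where
    ⇒ : hasOne T⁺ (suc c) ≡ true → lookup row c ∨ H c ≡ true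
    ⇒ eq with to hasOne-suc (does⁻ (hasOne? T⁺ (suc c)) eq)
    ... | inj₁ c∈row = ≡.cong (_∨ H c) ([]=⇒lookup c∈row)
    ... | inj₂ h     = ≡.trans (≡.cong (lookup row c ∨_) (dec-true (hasOne? T c) h)) (∨-zeroʳ _)
    ⇐ : lookup row c ∨ H c ≡ true → hasOne T⁺ (suc c) ≡ true
    ⇐ eq with lookup row c in b
    ... | true  = dec-true (hasOne? T⁺ (suc c)) (from hasOne-suc (inj₁ (lookup⇒[]= c row b)))
    ... | false = dec-true (hasOne? T⁺ (suc c)) (from hasOne-suc (inj₂ (does⁻ (hasOne? T c) eq)))

  isUnrestricted-prepend : Compatible → ∀ c → isUnrestricted T⁺ (suc c) ≡ unrestricted′ U row c
  isUnrestricted-prepend compat c = ≡-via-true ⇒ ⇐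
    where
    ⇒ : isUnrestricted T⁺ (suc c) ≡ true → U c ∧ (lookup row c ∨ not (left row c)) ≡ true
    ⇒ eq with to (unrestricted-suc compat) (does⁻ (unrestrictedColumn? T⁺ (suc c)) eq)
    ... | unr , inj₁ c∈row = ≡.cong₂ _∧_ (dec-true (unrestrictedColumn? T c) unr)
      (≡.cong (_∨ not (left row c)) ([]=⇒lookup c∈row))
    ... | unr , inj₂ ¬l    = ≡.cong₂ _∧_ (dec-true (unrestrictedColumn? T c) unr)
      (≡.trans (≡.cong (λ b → lookup row c ∨ not b) (¬-not (¬l ∘ to (left⇔ row c)))) (∨-zeroʳ _))
    ⇐ : U c ∧ (lookup row c ∨ not (left row c)) ≡ true → isUnrestricted T⁺ (suc c) ≡ true
    ⇐ eq = dec-true (unrestrictedColumn? T⁺ (suc c)) (from (unrestricted-suc compat)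
      (does⁻ (unrestrictedColumn? T c) (∧-trueˡ _ _ eq) , in-or-left (∧-trueʳ (U c) _ eq)))
      where
      in-or-left : lookup row c ∨ not (left row c) ≡ true → c ∈ row ⊎ ¬ OneLeftOf row c
      in-or-left eq with lookup row c in b
      ... | true  = inj₁ (lookup⇒[]= c row b)
      ... | false = inj₂ λ l → not-¬ eq (≡.cong not (from (left⇔ row c) l))

  hasOne-prepend-zero : hasOne T⁺ zero ≡ false
  hasOne-prepend-zero = dec-false (hasOne? T⁺ zero) λ (r , o) → ¬one-zero {r} o

  isUnrestricted-prepend-zero : isUnrestricted T⁺ zero ≡ isWest s
  isUnrestricted-prepend-zero = by s ≡.refl
    where
    by : ∀ s′ → s ≡ s′ → isUnrestricted T⁺ zero ≡ isWest s′
    by south ≡.refl = dec-false (unrestrictedColumn? T⁺ zero) λ ()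
    by west  ≡.refl = dec-true (unrestrictedColumn? T⁺ zero) (≡.refl , λ { (_ , ((_ , _ , ()) , _) , _) })

-- Summation over tableaux

wordOf : ∀ {n} → Tableau n → Word
wordOf T = word (isUnrestricted T) (hasOne T)

wordOf-prepend : ∀ {n} s row (T : Tableau n) → let open Prepend s row T in Compatible →
  wordOf (prepend s row T) ≡
  letters (isWest s) false (word (unrestricted′ (isUnrestricted T) row) (hasOne′ (hasOne T) row))
wordOf-prepend s row T compat
  rewrite Prepend.isUnrestricted-prepend-zero s row T | Prepend.hasOne-prepend-zero s row T =
  ≡.cong (letters (isWest s) false)
    (word-cong (Prepend.isUnrestricted-prepend s row T compat) (Prepend.hasOne-prepend s row T))

¬extendable-one-zero : ∀ {n} {D : Diagram (suc n)} {F} r → zero ∈ lookup F r → ¬ IsExtendable (tableau D F)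
¬extendable-one-zero r o P with () ← proj₂ (proj₂ (IsExtendable.ones-in-cells P r zero o))

-- Extendability already gives every restricted column a 1. The remaining condition says that the
-- word has no letter e, which is what `ev` tests.
isPT⇔ : ∀ {n} {T : Tableau n} →
  IsPermutationTableau T ⇔ (IsExtendable T × (∀ c → UnrestrictedColumn T c → HasOne T c))
isPT⇔ {T = T} = mk⇔
  (λ P → let open IsPermutationTableau P in
    record { ones-in-cells = ones-in-cells ; no-bad-0 = no-bad-0
           ; restricted-has-one = λ { c (_ , ((_ , col , _) , _) , _) → column-has-1 c col } }
    , λ c (col , _) → column-has-1 c col)
  (λ (P , h) → let open IsExtendable P in
    record { ones-in-cells = ones-in-cells ; no-bad-0 = no-bad-0 ; column-has-1 = λ c col → has1 P h c col })
  where
  has1 : IsExtendable T → (∀ c → UnrestrictedColumn T c → HasOne T c) →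
         ∀ c → IsColumn (Tableau.diagram T) c → HasOne T c
  has1 P h c col with restricted? T c
  ... | yes x = IsExtendable.restricted-has-one P c x
  ... | no ¬x = h c (col , ¬x)

module TableauSum {c ℓ} (R : CommutativeRing c ℓ)
                (s t : CommutativeRing.Carrier R)
                (t≈1+s : CommutativeRing._≈_ R t (CommutativeRing._+_ R (CommutativeRing.1# R) s)) where
  open CommutativeRing R hiding (zero)
  open Transfer R s t t≈1+s
  open ListSum R
  open RowSum R s t t≈1+s
  open RawSemiringDefs (RawRing.rawSemiring rawRing) using (_^_)
  open ≈-Reasoning setoid

  weight : ∀ {n} → (Word → Carrier) → Tableau n → Carrier
  weight f T = does (isExtendable? T) ⊙ f (wordOf T)

  weight-prepend : ∀ {n} f r row (T : Tableau n) →
    weight f (prepend r row T) ≈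
    does (isExtendable? T) ⊙ admissible r (isUnrestricted T) (hasOne T) row ⊙
      f (letters (isWest r) false (word (unrestricted′ (isUnrestricted T) row) (hasOne′ (hasOne T) row)))
  weight-prepend f r row T = begin
    _ ≡⟨ ≡.cong (_⊙ f (wordOf (prepend r row T))) isExtendable-prepend ⟩
    _ ≡⟨ ⊙-∧ (does (isExtendable? T)) _ ⟩
    -- The formula for the new word presupposes compatibility, which is available under the bracket
    -- of `admissible`.
    _ ≈⟨ ⊙-cong (does (isExtendable? T)) (λ _ →
           ⊙-cong (admissible r (isUnrestricted T) (hasOne T) row) λ ok →
             reflexive (≡.cong f (wordOf-prepend r row T (to admissible⇔ ok)))) ⟩
    _ ∎
    where open Prepend r row T

  ∑-rows : ∀ {n} f (T : Tableau n) →
    (∑[ row ∈ subsets n ] weight f (prepend south row T)) + (∑[ row ∈ subsets n ] weight f (prepend west row T))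
    ≈ weight (step f) T
  ∑-rows {n} f T = begin
    _ ≈⟨ +-cong (∑-cong (subsets n) λ row → weight-prepend f south row T)
                (∑-cong (subsets n) λ row → weight-prepend f west row T) ⟩
    _ ≈⟨ +-cong (∑-⊙ (subsets n) ext _) (∑-⊙ (subsets n) ext _) ⟩
    _ ≈⟨ ⊙-+ ext ⟩
    _ ≈⟨ ⊙-cong ext (λ _ → +-cong (∑-compatible U H f) (∑-zeroRow U H (f ∘ (e ∷_)))) ⟩
    _ ≈⟨ ⊙-cong ext (λ _ → +-comm _ _) ⟩
    weight (step f) T ∎
    where
    ext = does (isExtendable? T)
    U = isUnrestricted T
    H = hasOne T

  -- A filling without 1's in the column of label `zero` is a smaller filling with `false` put in
  -- front of each line. The number `m` of lines is kept apart from `n` for the induction.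
  ∑-emptyColumn : ∀ n m (g : Vec (Subset (suc n)) m → Carrier) →
    (∀ F r → zero ∈ lookup F r → g F ≈ 0#) →
    ∑ (allVecs (subsets (suc n)) m) g ≈ ∑ (allVecs (subsets n) m) (g ∘ Vec.map (false ∷_))
  ∑-emptyColumn n zero    g g≈0 = refl
  ∑-emptyColumn n (suc m) g g≈0 = begin
    _ ≈⟨ ∑-cartesianProductWith _∷_ (subsets (suc n)) (allVecs (subsets (suc n)) m) g ⟩
    _ ≈⟨ ∑-subsets n _ ⟩
    _ ≈⟨ +-cong
           (∑-cong (subsets n) λ row → ∑-emptyColumn n m (g ∘ ((false ∷ row) ∷_)) (λ F r → g≈0 _ (suc r)))
           (∑-vanishes (subsets n) λ row → ∑-vanishes (allVecs (subsets (suc n)) m) λ F → g≈0 _ zero here) ⟩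
    _ ≈⟨ +-identityʳ _ ⟩
    _ ≈⟨ ∑-cartesianProductWith _∷_ (subsets n) (allVecs (subsets n) m) (g ∘ Vec.map (false ∷_)) ⟨
    _ ∎

  -- Fillings not of the form `prepend r row T` are not extendable and drop out; summing over `r`
  -- and `row` for fixed `T` is then one `step`.
  ∑-allTableaux-suc : ∀ n (f : Word → Carrier) →
    ∑ (allTableaux (suc n)) (weight f) ≈ ∑ (allTableaux n) (weight (step f))
  ∑-allTableaux-suc n f = begin
    ∑ (allTableaux (suc n)) (weight f)
      ≈⟨ ∑-cartesianProductWith tableau (allVecs allSteps (suc n)) fillings⁺ (weight f) ⟩
    (∑[ D ∈ allVecs allSteps (suc n) ] ∑[ F ∈ fillings⁺ ] weight f (tableau D F))
      ≈⟨ ∑-cartesianProductWith _∷_ allSteps diagrams _ ⟩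
    (∑[ r ∈ allSteps ] ∑[ D ∈ diagrams ] ∑[ F ∈ fillings⁺ ] weight f (tableau (r ∷ D) F))
      ≈⟨ ∑-cong allSteps (λ r → trans (∑-cong diagrams (strip r)) (collect r)) ⟩
    (∑[ r ∈ allSteps ] ∑[ T ∈ allTableaux n ] ∑[ row ∈ subsets n ] weight f (prepend r row T))
      ≈⟨ +-congˡ (+-identityʳ _) ⟩
    (∑[ T ∈ allTableaux n ] ∑[ row ∈ subsets n ] weight f (prepend south row T))
      + (∑[ T ∈ allTableaux n ] ∑[ row ∈ subsets n ] weight f (prepend west row T))
      ≈⟨ ∑-+ (allTableaux n) _ _ ⟨
    _ ≈⟨ ∑-cong (allTableaux n) (∑-rows f) ⟩
    ∑ (allTableaux n) (weight (step f)) ∎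
    where
    allSteps = south ∷ west ∷ []
    diagrams = allVecs allSteps n
    fillings = allVecs (subsets n) n
    fillings⁺ = allVecs (subsets (suc n)) (suc n)

    strip : ∀ r D → (∑[ F ∈ fillings⁺ ] weight f (tableau (r ∷ D) F)) ≈
                    (∑[ F ∈ fillings ] ∑[ row ∈ subsets n ] weight f (prepend r row (tableau D F)))
    strip r D = begin
      -- Once the column of the new label is empty, the first line of the filling gives `row` and
      -- the others form the filling of the smaller tableau.
      _ ≈⟨ ∑-emptyColumn n (suc n) _ (λ F i o → reflexive
             (⊙-no (isExtendable? (tableau (r ∷ D) F)) (¬extendable-one-zero i o))) ⟩
      _ ≈⟨ ∑-cartesianProductWith _∷_ (subsets n) fillings _ ⟩
      _ ≈⟨ ∑-comm (subsets n) fillings (λ row F → weight f (prepend r row (tableau D F))) ⟩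
      _ ∎

    collect : ∀ r → (∑[ D ∈ diagrams ] ∑[ F ∈ fillings ] ∑[ row ∈ subsets n ] weight f (prepend r row (tableau D F))) ≈
                    (∑[ T ∈ allTableaux n ] ∑[ row ∈ subsets n ] weight f (prepend r row T))
    collect r = sym (∑-cartesianProductWith tableau diagrams fillings _)

  -- Each label removed from the tableaux becomes one more `step` on the function, so `k` counts the
  -- labels removed so far. In the end only the empty tableau is left, with the empty word.
  ∑-weight-steps : ∀ n k → ∑ (allTableaux n) (weight (steps k)) ≈ total (n ℕ.+ k)
  ∑-weight-steps zero    k = trans (+-identityʳ _) (reflexive (⊙-yes (isExtendable? (tableau [] [])) empty))
    where
    empty : IsExtendable (tableau [] [])
    empty = record { ones-in-cells = λ () ; no-bad-0 = λ () ; restricted-has-one = λ () }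
  ∑-weight-steps (suc n) k = begin
    ∑ (allTableaux (suc n)) (weight (steps k))  ≈⟨ ∑-allTableaux-suc n (steps k) ⟩
    ∑ (allTableaux n) (weight (steps (suc k)))  ≈⟨ ∑-weight-steps n (suc k) ⟩
    total (n ℕ.+ suc k)                         ≡⟨ ≡.cong total (ℕ.+-suc n k) ⟩
    total (suc n ℕ.+ k)                         ∎

  -- `g` generalizes the identity so that the induction can pass to `g ∘ suc`; `allFin n` is
  -- `tabulate id`.
  ev-word : ∀ {n m} {P : Fin m → Set} (P? : Decidable P) (H : Fin m → Bool) (g : Fin n → Fin m) →
    (∀ c → P c → H c ≡ true) →
    ev (word (λ c → does (P? (g c))) (H ∘ g)) ≈ t ^ length (filter P? (tabulate g))
  ev-word {zero}  P? H g h = refl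
  ev-word {suc n} P? H g h with P? (g zero)
  ... | no  _ = ev-word P? H (g ∘ suc) h
  ... | yes p rewrite h (g zero) p = *-congˡ (ev-word P? H (g ∘ suc) h)

  ev-word-vanishes : ∀ {n} {U H : Fin n → Bool} c → U c ≡ true → H c ≡ false → ev (word U H) ≈ 0#
  ev-word-vanishes zero    Uc Hc rewrite Uc | Hc = refl
  ev-word-vanishes {U = U} {H} (suc c) Uc Hc with U zero | H zero
  ... | false | _     = ev-word-vanishes c Uc Hc
  ... | true  | false = refl
  ... | true  | true  = trans (*-congˡ (ev-word-vanishes c Uc Hc)) (zeroʳ t)

  ev-wordOf-vanishes : ∀ {n} (T : Tableau n) → ¬ (∀ c → UnrestrictedColumn T c → HasOne T c) → ev (wordOf T) ≈ 0#
  ev-wordOf-vanishes {n} T ¬h with ¬∀⟶∃¬ n _ (λ c → unrestrictedColumn? T c →-dec hasOne? T c) ¬h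
  ... | c , ¬imp = ev-word-vanishes c
    (dec-true (unrestrictedColumn? T c) (decidable-stable (unrestrictedColumn? T c)
      λ ¬unr → ¬imp λ unr → contradiction unr ¬unr))
    (dec-false (hasOne? T c) λ h → ¬imp λ _ → h)

  -- Among the extendable tableaux, `ev` kills those with an unrestricted column lacking a 1; in the
  -- others each unrestricted column is a letter u and contributes a factor t.
  weight-ev : ∀ {n} (T : Tableau n) → does (isPermutationTableau? T) ⊙ t ^ urc T ≈ weight ev T
  weight-ev T = by (isExtendable? T) (all? λ c → unrestrictedColumn? T c →-dec hasOne? T c)
    where
    by : Dec (IsExtendable T) → Dec (∀ c → UnrestrictedColumn T c → HasOne T c) →
         does (isPermutationTableau? T) ⊙ t ^ urc T ≈ weight ev T
    by (no ¬P) _ = begin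
      does (isPermutationTableau? T) ⊙ t ^ urc T  ≡⟨ ⊙-no (isPermutationTableau? T) (¬P ∘ proj₁ ∘ to isPT⇔) ⟩
      0#                                          ≡⟨ ⊙-no (isExtendable? T) ¬P ⟨
      weight ev T                                 ∎
    by (yes P) (no ¬h) = begin
      does (isPermutationTableau? T) ⊙ t ^ urc T  ≡⟨ ⊙-no (isPermutationTableau? T) (¬h ∘ proj₂ ∘ to isPT⇔) ⟩
      0#                                          ≈⟨ ev-wordOf-vanishes T ¬h ⟨
      ev (wordOf T)                               ≡⟨ ⊙-yes (isExtendable? T) P ⟨
      weight ev T                                 ∎
    by (yes P) (yes h) = begin
      does (isPermutationTableau? T) ⊙ t ^ urc T  ≡⟨ ⊙-yes (isPermutationTableau? T) (from isPT⇔ (P , h)) ⟩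
      t ^ urc T                                   ≈⟨ ev-word (unrestrictedColumn? T) (hasOne T) id
                                                       (λ c unr → dec-true (hasOne? T c) (h c unr)) ⟨
      ev (wordOf T)                               ≡⟨ ⊙-yes (isExtendable? T) P ⟨
      weight ev T                                 ∎

  ∑-PT : ∀ n → ∑[ T ∈ PT n ] t ^ urc T ≈ total n
  ∑-PT n = begin
    (∑[ T ∈ PT n ] t ^ urc T)         ≈⟨ ∑-filter isPermutationTableau? (λ T → t ^ urc T) (allTableaux n) ⟩
    _                                 ≈⟨ ∑-cong (allTableaux n) weight-ev ⟩
    ∑ (allTableaux n) (weight ev)     ≈⟨ ∑-weight-steps n 0 ⟩
    total (n ℕ.+ 0)                   ≡⟨ ≡.cong total (ℕ.+-identityʳ n) ⟩
    total n                           ∎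

-- Specialization to integer polynomials in t

open PolynomialRing using (ℤ[t]-commutativeRing)

private module ℤ[t] = CommutativeRing ℤ[t]-commutativeRing

t≈1+[t-1] : t ℤ[t].≈ ℤ[t].1# ℤ[t].+ t-1
t≈1+[t-1] = Polynomial.mk≈ λ where
  zero          → ≡.refl
  (suc zero)    → ≡.refl
  (suc (suc k)) → ≡.refl

open Transfer ℤ[t]-commutativeRing t-1 t t≈1+[t-1] using (risingFactorialᴿ)
open Quotient ℤ[t]-commutativeRing t-1 t t≈1+[t-1] using (total≈quotient)
open TableauSum ℤ[t]-commutativeRing t-1 t t≈1+[t-1] using (∑-PT)
open RawSemiringDefs (RawRing.rawSemiring ℤ[t]) using () renaming (_×_ to _·_)

risingFactorial≡ : ∀ n → risingFactorial t n ≡ risingFactorialᴿ n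
risingFactorial≡ zero    = ≡.refl
risingFactorial≡ (suc n) = ≡.cong (ℤ[t]._* (t ℤ[t].+ n · ℤ[t].1#)) (risingFactorial≡ n)

open RawRing ℤ[t]⟦x⟧ using (_≈_; _+_; _*_; 1#)

theorem1p1 : tableauSeries ≈ (1# + E) / (1# + constant t-1 * x * E)
theorem1p1 n = ℤ[t].trans (∑-PT n) (total≈quotient E ℤ[t].refl
  (λ n → ℤ[t].reflexive (≡.cong (suc n ·_) (risingFactorial≡ n))) n)
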